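{- Let $T$ be a $2$-dependent theory with monster model $\mathbb{M}$, let $\kappa\geq|T|$ be an infinite cardinal, and let $\lambda>\kappa$ be a regular cardinal. Then for any mutually indiscernible sequences $I=(a_i:i\in\kappa)$, $J=(b_j:j\in\lambda)$ of finite tuples and a finite tuple $c$ (all in $\mathbb{M}$), there is some $\beta\in\lambda$ such that $$|S_{J_{>\beta}}(I\times\{c\})|\leq(\mathrm{ded}\,\kappa)^{|T|}.$$
   Context: $T$ is a complete theory in a language $\mathcal{L}$ and $\mathbb{M}\models T$ is a monster model (saturated and homogeneous for a sufficiently large strongly inaccessible cardinal, larger than $\kappa$ and $\lambda$). $J_{>\beta}:=\{b_j:j\in\lambda,\ j>\beta\}$. For sets of tuples $B\subseteq\mathbb{M}_x$ and $A\subseteq\mathbb{M}_y$ ($\mathbb{M}_x$ denotes the product of sorts corresponding to the tuple of variables $x$), $S_B(A)$ denotes the set of all complete types over $A$ realized in $B$, i.e. $\{\mathrm{tp}(b/A):b\in B\}$. For an infinite cardinal $\kappa$, $\mathrm{ded}\,\kappa$ is the supremum of the number of Dedekind cuts among all linear orders of cardinality $\kappa$. Sequences $I,J$ are mutually indiscernible if each is indiscernible over the other. A partitioned formula $\varphi(x;y_1,y_2)$ is not $2$-dependent (with respect to $T$) if in some model of $T$ there are tuples $(a_{1,i},a_{2,i})_{i\in\omega}$ such that for every $s\subseteq\omega^2$ there is a tuple $e_s$ with $\models\varphi(e_s;a_{1,i_1},a_{2,i_2})\Leftrightarrow(i_1,i_2)\in s$; otherwise it is $2$-dependent. $T$ is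 $2$-dependent if every formula is. -}

module Defs where

open import Level using (Level; Setω; suc; 0ℓ; _⊔_)
open import Axiom.ExcludedMiddle using (ExcludedMiddle)
open import Axiom.Extensionality.Propositional using (Extensionality)
open import Data.Bool.Base using (Bool)
open import Data.Empty.Polymorphic using (⊥)
open import Data.Fin.Base using (Fin) renaming (zero to fzero; suc to fsuc; _<_ to _<ᶠ_)
open import Data.List.Base using (List; []; _∷_; _++_)
open import Data.List.Membership.Propositional using (_∈_)
import Data.List.Relation.Unary.All as All
open import Data.List.Relation.Unary.All using (All; []; _∷_)
open import Data.List.Relation.Unary.All.Properties using (++⁺)
open import Data.Nat.Base using (ℕ) renaming (zero to nzero; suc to nsuc)
open import Data.Product.Base using (Σ-syntax; ∃; ∃-syntax; _×_; _,_; proj₁)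
open import Data.Sum.Base using (_⊎_)
open import Function.Base using (_∘_)
open import Function.Bundles using (Injection; Bijection; _⇔_)
open import Function.Definitions using (Injective; Bijective)
open import Induction.WellFounded using (WellFounded)
open import Relation.Binary.Bundles using (Setoid; StrictTotalOrder)
open import Relation.Binary.Core using (Rel)
import Relation.Binary.Construct.On as On
open import Relation.Binary.PropositionalEquality using (_≡_; setoid; _→-setoid_)
open import Relation.Binary.Structures using (IsStrictTotalOrder)
open import Relation.Nullary using (¬_)
import Relation.Unary as U
open import Relation.Unary using (Pred)
open import Relation.Unary.Properties using (≐-refl; ≐-sym; ≐-trans)

private
  variable
    a b c d ℓ : Level

-- The classical metatheory.  As excluded middle applies to arbitrary types, it
-- also provides choice; extensionality makes the choices invariant under
-- extensional equality of subsets.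

record Classical : Setω where
  field
    excludedMiddle : ∀ {ℓ} → ExcludedMiddle ℓ
    extensionality : ∀ {a b} → Extensionality a b

------------------------------------------------------------------------
-- Cardinals
--
-- Sizes are compared between setoids, since subsets and sets of types carry a
-- non-trivial extensional equality.

infix 4 _≤ᶜ_ _<ᶜ_ _≈ᶜ_

_≤ᶜ_ : Setoid a b → Setoid c d → Set (a ⊔ b ⊔ c ⊔ d)
A ≤ᶜ B = Injection A B

_<ᶜ_ : Setoid a b → Setoid c d → Set (a ⊔ b ⊔ c ⊔ d)
A <ᶜ B = A ≤ᶜ B × ¬ (B ≤ᶜ A)

_≈ᶜ_ : Setoid a b → Setoid c d → Set (a ⊔ b ⊔ c ⊔ d)
A ≈ᶜ B = Bijection A B

-- Cardinals are initial ordinals.  In `initial` the map lands in the segment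
-- below i; a function into Σ j (j < i) would count proofs of j < i as well.

record Cardinal ℓ : Set (suc ℓ) where
  infix 4 _<_
  field
    Carrier            : Set ℓ
    _<_                : Rel Carrier ℓ
    isStrictTotalOrder : IsStrictTotalOrder _≡_ _<_
    wellFounded        : WellFounded _<_
    initial            : ∀ i → ¬ (Σ[ f ∈ (Carrier → Carrier) ]
                                  Injective _≡_ _≡_ f × (∀ x → f x < i))

∣_∣ : Cardinal ℓ → Setoid ℓ ℓ
∣ κ ∣ = setoid (Cardinal.Carrier κ)

Infinite : Cardinal ℓ → Set ℓ
Infinite κ = setoid ℕ ≤ᶜ ∣ κ ∣

-- No map from a smaller ordinal is cofinal; only the values of f below i matter.

Regular : Cardinal ℓ → Set ℓ
Regular κ = Infinite κ ×
            (∀ (i : Carrier) (f : Carrier → Carrier) →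
               ∃[ u ] (∀ j → j < i → f j < u))
  where open Cardinal κ

StronglyInaccessible : Cardinal ℓ → Set (suc ℓ)
StronglyInaccessible {ℓ} θ =
  Regular θ ×
  setoid ℕ <ᶜ ∣ θ ∣ ×
  (∀ (μ : Cardinal ℓ) → ∣ μ ∣ <ᶜ ∣ θ ∣ →
     (Cardinal.Carrier μ →-setoid Bool) <ᶜ ∣ θ ∣)

-- Dedekind cuts: partitions of a linear order into a lower and an upper part.
-- Empty parts are allowed, which does not affect ded κ for infinite κ.

record Cut (O : StrictTotalOrder ℓ ℓ ℓ) : Set (suc ℓ) where
  open StrictTotalOrder O
  field
    lower upper : Pred Carrier ℓ
    cover       : ∀ x → lower x ⊎ upper x
    separated   : ∀ {x y} → lower x → upper y → x < y

Cuts : StrictTotalOrder ℓ ℓ ℓ → Setoid (suc ℓ) ℓ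
Cuts O = record
  { Carrier       = Cut O
  ; _≈_           = λ C D → lower C U.≐ lower D × upper C U.≐ upper D
  ; isEquivalence = record
    { refl  = ≐-refl , ≐-refl
    ; sym   = λ (p , q) → ≐-sym p , ≐-sym q
    ; trans = λ (p , q) (p′ , q′) → ≐-trans p p′ , ≐-trans q q′
    }
  }
  where open Cut

BoundsCuts : Cardinal ℓ → Cardinal ℓ → Set (suc ℓ)
BoundsCuts {ℓ} κ δ =
  ∀ (O : StrictTotalOrder ℓ ℓ ℓ) → StrictTotalOrder.Eq.setoid O ≈ᶜ ∣ κ ∣ →
  Cuts O ≤ᶜ ∣ δ ∣

-- δ = ded κ; a supremum of cardinals is determined by its universal property.

_IsDed_ : Cardinal ℓ → Cardinal ℓ → Set (suc ℓ)
δ IsDed κ = BoundsCuts κ δ × (∀ δ′ → BoundsCuts κ δ′ → ∣ δ ∣ ≤ᶜ ∣ δ′ ∣)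

------------------------------------------------------------------------
-- Many-sorted first-order logic

record Language ℓ : Set (suc ℓ) where
  field
    Sort : Set ℓ
    Fun  : List Sort → Sort → Set ℓ
    Rela : List Sort → Set ℓ

-- A tuple of variables is given by the list of its sorts.

Ctx : Language ℓ → Set ℓ
Ctx L = List (Language.Sort L)

module _ (L : Language ℓ) where
  open Language L

  data Term (Γ : Ctx L) : Sort → Set ℓ where
    var : ∀ {s} → s ∈ Γ → Term Γ s
    app : ∀ {ss s} → Fun ss s → All (Term Γ) ss → Term Γ s

  infix  6 _≈̇_
  infixr 5 _⇒̇_

  data Formula (Γ : Ctx L) : Set ℓ where
    ⊥̇   : Formula Γ
    _≈̇_ : ∀ {s} → Term Γ s → Term Γ s → Formula Γ
    rel : ∀ {ss} → Rela ss → All (Term Γ) ss → Formula Γ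
    _⇒̇_ : Formula Γ → Formula Γ → Formula Γ
    ∀̇   : ∀ s → Formula (s ∷ Γ) → Formula Γ

  record Structure : Set (suc ℓ) where
    field
      Carrier   : Sort → Set ℓ
      inhabited : ∀ s → Carrier s
      fun       : ∀ {ss s} → Fun ss s → All Carrier ss → Carrier s
      rela      : ∀ {ss} → Rela ss → All Carrier ss → Set ℓ

  Theory : Set (suc ℓ)
  Theory = Pred (Formula []) ℓ

module _ {L : Language ℓ} where
  open Language L

  -- T is tacitly the set of its consequences, so |T| = |L| + ℵ₀ is the number of
  -- L-formulas.

  ∣_∣ᵀ : Theory L → Setoid ℓ ℓ
  ∣ T ∣ᵀ = setoid (∃ (Formula L))

  -- The product of sorts M_x.

  Tuple : Structure L → Ctx L → Set ℓ
  Tuple M x = All (Structure.Carrier M) x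

  module _ (M : Structure L) where
    open Structure M

    eval  : ∀ {Γ s} → Tuple M Γ → Term L Γ s → Carrier s
    evals : ∀ {Γ ss} → Tuple M Γ → All (Term L Γ) ss → Tuple M ss

    eval e (var v)    = All.lookup e v
    eval e (app f ts) = fun f (evals e ts)

    evals e []       = []
    evals e (t ∷ ts) = eval e t ∷ evals e ts

    infix 4 _⊨_[_]

    _⊨_[_] : ∀ {Γ} → Formula L Γ → Tuple M Γ → Set ℓ
    _⊨_[_] ⊥̇         e = ⊥
    _⊨_[_] (t ≈̇ u)   e = eval e t ≡ eval e u
    _⊨_[_] (rel R ts) e = rela R (evals e ts)
    _⊨_[_] (φ ⇒̇ ψ)   e = _⊨_[_] φ e → _⊨_[_] ψ e
    _⊨_[_] (∀̇ s φ)   e = ∀ m → _⊨_[_] φ (m ∷ e)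

  _IsModelOf_ : Structure L → Theory L → Set ℓ
  M IsModelOf T = ∀ {σ} → T σ → M ⊨ σ [ [] ]

  Complete : Theory L → Set (suc ℓ)
  Complete T =
    ∃[ M ] M IsModelOf T ×
    (∀ σ → (∀ N → N IsModelOf T → N ⊨ σ [ [] ])
         ⊎ (∀ N → N IsModelOf T → N ⊨ σ ⇒̇ ⊥̇ [ [] ]))

  NotTwoDependentFormula : Theory L → ∀ x y₁ y₂ → Formula L (x ++ y₁ ++ y₂) → Set (suc ℓ)
  NotTwoDependentFormula T x y₁ y₂ φ =
    Σ[ N ∈ Structure L ] N IsModelOf T ×
    Σ[ a₁ ∈ (ℕ → Tuple N y₁) ] Σ[ a₂ ∈ (ℕ → Tuple N y₂) ]
    (∀ (S : Pred (ℕ × ℕ) 0ℓ) →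
       Σ[ e ∈ Tuple N x ] (∀ i₁ i₂ → (N ⊨ φ [ ++⁺ e (++⁺ (a₁ i₁) (a₂ i₂)) ]) ⇔ S (i₁ , i₂)))

  TwoDependent : Theory L → Set (suc ℓ)
  TwoDependent T = ∀ x y₁ y₂ φ → ¬ NotTwoDependentFormula T x y₁ y₂ φ

  ----------------------------------------------------------------------
  -- Types over parameter sets

  module _ (M : Structure L) where
    open Structure M

    Params : Set (suc ℓ)
    Params = ∀ s → Pred (Carrier s) ℓ

    ∣_∣ᴾ : Params → Setoid ℓ ℓ
    ∣ A ∣ᴾ = On.setoid {B = Σ[ s ∈ Sort ] Σ[ m ∈ Carrier s ] A s m} (setoid (∃ Carrier))
                       (λ (s , m , _) → s , m)

    _⊆ᴾ_ : ∀ {z} → Tuple M z → Params → Set ℓ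
    d ⊆ᴾ A = ∀ {s} (v : s ∈ _) → A s (All.lookup d v)

    -- A set of tuples used as a set of parameters: the coordinates of its members.

    coords : ∀ {y} → Pred (Tuple M y) ℓ → Params
    coords {y} B s m = ∃[ e ] B e × Σ[ v ∈ s ∈ y ] All.lookup e v ≡ m

    record FormulaOver (A : Params) (x : Ctx L) : Set ℓ where
      constructor mkFormulaOver
      field
        {z}     : Ctx L
        formula : Formula L (x ++ z)
        params  : Tuple M z
        inA     : params ⊆ᴾ A

    tp : ∀ {x} (A : Params) → Tuple M x → Pred (FormulaOver A x) ℓ
    tp A e ψ = M ⊨ formula [ ++⁺ e params ]
      where open FormulaOver ψ

    -- S B A is { tp(b/A) : b ∈ B }.

    S : ∀ {x y} → Pred (Tuple M x) ℓ → Pred (Tuple M y) ℓ → Setoid (suc ℓ) ℓ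
    S {x} B A = On.setoid
      {B = Σ[ p ∈ Pred (FormulaOver (coords A) x) ℓ ] ∃[ b ] B b × p U.≐ tp (coords A) b}
      (record { _≈_           = U._≐_
              ; isEquivalence = record { refl = ≐-refl ; sym = ≐-sym ; trans = ≐-trans } })
      proj₁

    --------------------------------------------------------------------
    -- Monster models

    record Automorphism : Set ℓ where
      field
        σ         : ∀ {s} → Carrier s → Carrier s
        bijective : ∀ {s} → Bijective _≡_ _≡_ (σ {s})
        σ-fun     : ∀ {ss s} (f : Fun ss s) e → σ (fun f e) ≡ fun f (All.map σ e)
        σ-rela    : ∀ {ss} (R : Rela ss) e → rela R e ⇔ rela R (All.map σ e)

    Saturated : Cardinal ℓ → Set (suc ℓ)
    Saturated θ =
      ∀ (A : Params) → ∣ A ∣ᴾ <ᶜ ∣ θ ∣ →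
      ∀ x (p : Pred (FormulaOver A x) ℓ) →
      (∀ (ψs : List (FormulaOver A x)) → All p ψs → ∃[ e ] All (tp A e) ψs) →
      ∃[ e ] p U.⊆ tp A e

    -- A partial map is a total one of which only the restriction to A matters.

    ElementaryOn : Params → (∀ {s} → Carrier s → Carrier s) → Set ℓ
    ElementaryOn A f =
      ∀ {z} (φ : Formula L z) (d : Tuple M z) → d ⊆ᴾ A →
      (M ⊨ φ [ d ]) ⇔ (M ⊨ φ [ All.map f d ])

    Homogeneous : Cardinal ℓ → Set (suc ℓ)
    Homogeneous θ =
      ∀ (A : Params) → ∣ A ∣ᴾ <ᶜ ∣ θ ∣ →
      ∀ (f : ∀ {s} → Carrier s → Carrier s) → ElementaryOn A f →
      Σ[ α ∈ Automorphism ] (∀ {s} m → A s m → Automorphism.σ α m ≡ f m)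

  record IsMonster (T : Theory L) (θ : Cardinal ℓ) (M : Structure L) : Set (suc ℓ) where
    field
      isModel      : M IsModelOf T
      inaccessible : StronglyInaccessible θ
      saturated    : Saturated M θ
      homogeneous  : Homogeneous M θ

  ----------------------------------------------------------------------
  -- Indiscernible sequences

  power : ℕ → Ctx L → Ctx L
  power nzero    y = []
  power (nsuc n) y = y ++ power n y

  module _ (M : Structure L) where

    join : ∀ {y} n → (Fin n → Tuple M y) → Tuple M (power n y)
    join nzero    t = []
    join (nsuc n) t = ++⁺ (t fzero) (join n (t ∘ fsuc))

    range : ∀ {I : Set ℓ} {y} → (I → Tuple M y) → Pred (Tuple M y) ℓ
    range a e = ∃[ i ] a i ≡ e

    module _ (κ : Cardinal ℓ) where
      open Cardinal κ

      Increasing : ∀ {n} → (Fin n → Carrier) → Set ℓ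
      Increasing i = ∀ {p q} → p <ᶠ q → i p < i q

      IndiscernibleOver : ∀ {y} → Params M → (Carrier → Tuple M y) → Set ℓ
      IndiscernibleOver A a =
        ∀ n (i j : Fin n → Carrier) → Increasing i → Increasing j →
        tp M A (join n (a ∘ i)) U.≐ tp M A (join n (a ∘ j))

      tailAfter : ∀ {y} → (Carrier → Tuple M y) → Carrier → Pred (Tuple M y) ℓ
      tailAfter b β e = ∃[ j ] β < j × b j ≡ e

    MutuallyIndiscernible : ∀ (κ μ : Cardinal ℓ) {y z} →
      (Cardinal.Carrier κ → Tuple M y) → (Cardinal.Carrier μ → Tuple M z) → Set ℓ
    MutuallyIndiscernible κ μ a b =
      IndiscernibleOver κ (coords M (range b)) a ×
      IndiscernibleOver μ (coords M (range a)) b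

    _×｛_｝ : ∀ {y w} → Pred (Tuple M y) ℓ → Tuple M w → Pred (Tuple M (y ++ w)) ℓ
    (B ×｛ c ｝) e = ∃[ b ] B b × ++⁺ b c ≡ e

{-# OPTIONS --safe #-}
-- For one formula φ(z; y₁ … yₘ; c), let every b_j define a subset of κᵐ.  If for
-- each n every tail of J shattered an n-subset of κᵐ, then, as κ < λ = cf λ, a
-- single n-subset would be shattered by all tails, so that every finite bipartite
-- graph would appear between it and an increasing part of J.  As J is indiscernible
-- over I, the part of J can be fixed at the cost of varying c, and by saturation φ
-- is not 2-dependent.  Hence some tail of J shatters no n-subset, and β can be
-- chosen for all formulas at once since |T| ≤ κ < λ.
--
-- A family F of subsets of κ that shatters no n-set embeds into (ded κ)ⁿ (Shelah).
-- By induction on n, call an initial segment of a member of F thin if the members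
-- extending it shatter no (n-1)-set.  A thick one is determined by its length and
-- any (n-1)-set that it shatters, so there are at most κ of them.  A member of F is
-- determined by its cut in their lexicographic order and, if it has a thin initial
-- segment, by its place among the members extending the shortest one.

module Submission where

open import Defs
open import Level using (Level; _⊔_; lift; lower)
open import Axiom.Extensionality.Propositional using (implicit-extensionality)
open import Data.Bool.Base using (Bool; true; false)
import Data.Bool.Properties as Bool
open import Data.Empty using (⊥-elim)
open import Data.Fin.Base as Fin using (Fin; fromℕ<; toℕ; combine; inject₁)
open import Data.Fin.Patterns using (0F; 1F; 2F)
import Data.Fin.Properties as Fin
open import Data.List.Base using (List; []; _∷_; _++_)
open import Data.List.Membership.Propositional using (_∈_)
open import Data.List.Membership.Propositional.Properties using (∈-++⁺ˡ; ∈-++⁺ʳ; ∈-++⁻)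
import Data.List.Relation.Unary.All as All
open import Data.List.Relation.Unary.All using (All; []; _∷_)
open import Data.List.Relation.Unary.All.Properties using (++⁺)
open import Data.List.Relation.Unary.Any using (here; there; index)
open import Data.Nat.Base as ℕ using (ℕ; zero; suc; _*_)
import Data.Nat.Induction as ℕ
import Data.Nat.Properties as ℕ
open import Data.Product.Base using (Σ-syntax; ∃; ∃-syntax; _×_; _,_; proj₁; proj₂)
open import Data.Product.Properties using (,-injective)
open import Data.Product.Properties.WithK using (,-injectiveʳ)
open import Data.Product.Relation.Binary.Lex.Strict using (×-Lex; ×-wellFounded; ×-strictTotalOrder)
open import Data.Sum.Base using (_⊎_; inj₁; inj₂; [_,_]′)
open import Data.Sum.Properties using (inj₁-injective; inj₂-injective)
open import Data.Sum.Relation.Binary.LeftOrder using (_⊎-<_; ₁∼₁; ₁∼₂; ₂∼₂; ⊎-<-wellFounded)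
open import Data.Vec.Base as Vec using (Vec; []; _∷_; lookup; tabulate)
open import Data.Vec.Properties using (lookup-map; lookup∘tabulate)
open import Function.Base using (_∘_; _on_; id; const)
open import Function.Bundles using (Injection; _⇔_; mk⇔; Equivalence)
open import Function.Construct.Composition using (_⇔-∘_) renaming (injection to injection-∘)
open import Function.Definitions using (Injective; StrictlySurjective)
open import Induction.WellFounded using (WellFounded; Acc; acc; module FixPoint; wf⇒asym)
  renaming (module All to WellFoundedAll)
open import Relation.Binary.Bundles using (Setoid; StrictTotalOrder)
open import Relation.Binary.Core using (Rel)
import Relation.Binary.Construct.On as On
open import Relation.Binary.Definitions using (Trichotomous; Transitive; tri<; tri≈; tri>)
open import Relation.Binary.PropositionalEquality
open import Relation.Binary.Structures using (IsStrictTotalOrder)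
open import Relation.Binary.Structures.Biased using (isStrictTotalOrderᶜ)
open import Relation.Nullary using (¬_; Dec; yes; no; does)
open import Relation.Nullary.Decidable using (decidable-stable; does-⇔)
open import Relation.Unary using (Pred; _⊆_; U; _⟨×⟩_; _≐_)

open Equivalence using (to; from)

private
  variable
    a b p q r ℓ : Level
    A B C : Set a

-- Connex orders and embeddings of subsets.

Connex : {A : Set a} → Rel A r → Set (a ⊔ r)
Connex {A = A} _<_ = (x y : A) → x < y ⊎ x ≡ y ⊎ y < x

connex : {_<_ : Rel A r} → Trichotomous _≡_ _<_ → Connex _<_
connex compare x y with compare x y
... | tri< x<y _ _ = inj₁ x<y
... | tri≈ _ x≡y _ = inj₂ (inj₁ x≡y)
... | tri> _ _ y<x = inj₂ (inj₂ y<x)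

×-connex : {_<₁_ : Rel A p} {_<₂_ : Rel B q} → Connex _<₁_ → Connex _<₂_ →
           Connex (×-Lex _≡_ _<₁_ _<₂_)
×-connex c₁ c₂ (x , y) (x′ , y′) with c₁ x x′ | c₂ y y′
... | inj₁ x<x′        | _                = inj₁ (inj₁ x<x′)
... | inj₂ (inj₂ x′<x) | _                = inj₂ (inj₂ (inj₁ x′<x))
... | inj₂ (inj₁ refl) | inj₁ y<y′        = inj₁ (inj₂ (refl , y<y′))
... | inj₂ (inj₁ refl) | inj₂ (inj₁ refl) = inj₂ (inj₁ refl)
... | inj₂ (inj₁ refl) | inj₂ (inj₂ y′<y) = inj₂ (inj₂ (inj₂ (refl , y′<y)))

⊎-connex : {_<₁_ : Rel A p} {_<₂_ : Rel B q} → Connex _<₁_ → Connex _<₂_ →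
           Connex (_<₁_ ⊎-< _<₂_)
⊎-connex c₁ c₂ (inj₂ x) (inj₁ y) = inj₂ (inj₂ ₁∼₂)
⊎-connex c₁ c₂ (inj₁ x) (inj₂ y) = inj₁ ₁∼₂
⊎-connex c₁ c₂ (inj₁ x) (inj₁ y) with c₁ x y
... | inj₁ x<y         = inj₁ (₁∼₁ x<y)
... | inj₂ (inj₁ refl) = inj₂ (inj₁ refl)
... | inj₂ (inj₂ y<x)  = inj₂ (inj₂ (₁∼₁ y<x))
⊎-connex c₁ c₂ (inj₂ x) (inj₂ y) with c₂ x y
... | inj₁ x<y         = inj₁ (₂∼₂ x<y)
... | inj₂ (inj₁ refl) = inj₂ (inj₁ refl)
... | inj₂ (inj₂ y<x)  = inj₂ (inj₂ (₂∼₂ y<x))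

infix 1 _≼_

-- The map is total on `A` and only its restriction to `P` matters, so that proofs of `P x` are not
-- counted as elements.
record _≼_ {A : Set a} {B : Set b} (P : Pred A p) (Q : Pred B q) : Set (a ⊔ b ⊔ p ⊔ q) where
  constructor embedding
  field
    to        : A → B
    into      : ∀ x → P x → Q (to x)
    injective : ∀ x y → P x → P y → to x ≡ to y → x ≡ y

≼-trans : {P : Pred A p} {Q : Pred B q} {R : Pred C r} → P ≼ Q → Q ≼ R → P ≼ R
≼-trans (embedding f f-in f-inj) (embedding g g-in g-inj) =
  embedding (g ∘ f) (λ x → g-in (f x) ∘ f-in x)
    λ x y Px Py eq → f-inj x y Px Py (g-inj _ _ (f-in x Px) (f-in y Py) eq)

⊆⇒≼ : {P : Pred A p} {Q : Pred A q} → P ⊆ Q → P ≼ Q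
⊆⇒≼ P⊆Q = embedding (λ x → x) (λ _ → P⊆Q) λ _ _ _ _ eq → eq

≼-square : {P : Pred A p} {Q : Pred B q} → P ≼ Q → P ⟨×⟩ P ≼ Q ⟨×⟩ Q
≼-square (embedding f f-in f-inj) =
  embedding (λ (x , y) → f x , f y) (λ (x , y) (Px , Py) → f-in x Px , f-in y Py)
    λ (x , y) (x′ , y′) (Px , Py) (Px′ , Py′) eq → let eq₁ , eq₂ = ,-injective eq in
      cong₂ _,_ (f-inj x x′ Px Px′ eq₁) (f-inj y y′ Py Py′ eq₂)

-- Well-orders under excluded middle.

module WellOrders (classical : Classical) where
  open Classical classical

  em : (P : Set p) → Dec P
  em P = excludedMiddle {P = P}

  by-contradiction : {P : Set p} → ¬ ¬ P → P
  by-contradiction = decidable-stable (em _)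

  leftInverse : {A : Set a} {B : Set b} (f : A → B) → A → B → A
  leftInverse f x₀ y with em (∃[ x ] f x ≡ y)
  ... | yes (x , _) = x
  ... | no _        = x₀

  leftInverse-∘ : {A : Set a} {B : Set b} (f : A → B) (x₀ : A) → Injective _≡_ _≡_ f →
                  ∀ x → leftInverse f x₀ (f x) ≡ x
  leftInverse-∘ f x₀ f-inj x with em (∃[ x′ ] f x′ ≡ f x)
  ... | yes (_ , eq) = f-inj eq
  ... | no ∄         = ⊥-elim (∄ (x , refl))

  least : {A : Set a} {_<_ : Rel A r} → WellFounded _<_ → (P : Pred A p) →
          ∃ P → ∃[ m ] P m × (∀ x → x < m → ¬ P x)
  least {_<_ = _<_} wf P (x , Px) = go x (wf x) Px
    where
    go : ∀ x → Acc _<_ x → P x → ∃[ m ] P m × (∀ x → x < m → ¬ P x)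
    go x (acc rs) Px with em (∃[ y ] y < x × P y)
    ... | yes (y , y<x , Py) = go y (rs y<x) Py
    ... | no ∄               = x , Px , λ y y<x Py → ∄ (y , y<x , Py)

  -- t₀ is a junk value, taken when no fresh element of Q is left.

  module Rank {W : Set a} {_<_ : Rel W p} (<-wf : WellFounded _<_) (<-connex : Connex _<_)
              {T : Set b} {_⊏_ : Rel T q} (⊏-wf : WellFounded _⊏_)
              (t₀ : T) (Q : Pred T r) where

    Fresh : ∀ w → (∀ {v} → v < w → T) → Pred T _
    Fresh w ih t = Q t × (∀ {v} (v<w : v < w) → ih v<w ≢ t)

    step : ∀ w → (∀ {v} → v < w → T) → T
    step w ih with em (∃ (Fresh w ih))
    ... | yes fresh = proj₁ (least ⊏-wf _ fresh)
    ... | no _      = t₀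

    step-ext : ∀ w {ih ih′ : ∀ {v} → v < w → T} →
               (∀ {v} (v<w : v < w) → ih v<w ≡ ih′ v<w) → step w ih ≡ step w ih′
    step-ext w eq = cong (λ (f : ∀ {v} → v < w → T) → step w f)
                         (implicit-extensionality extensionality (extensionality eq))

    rank : W → T
    rank = WellFoundedAll.wfRec <-wf b (λ _ → T) step

    module _ {w : W} (big : ¬ (Q ≼ (_< w))) where

      private
        Below : Pred T _
        Below = Fresh w (λ {v} _ → rank v)

        -- If the ranks below `w` exhausted `Q`, choosing for each of its elements a `v` of that
        -- rank would embed `Q` in the segment below `w`.
        fresh : ∃ Below
        fresh = by-contradiction λ ∄ →
          let missed : ∀ t → Σ[ v ∈ W ] (Q t → v < w × rank v ≡ t)
              missed t = case-em t (em (∃[ v ] v < w × rank v ≡ t)) ∄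
          in big (embedding (proj₁ ∘ missed) (λ t Qt → proj₁ (proj₂ (missed t) Qt))
                    λ t t′ Qt Qt′ eq → trans (sym (proj₂ (proj₂ (missed t) Qt)))
                                         (trans (cong rank eq) (proj₂ (proj₂ (missed t′) Qt′))))
          where
          case-em : ∀ t → Dec (∃[ v ] v < w × rank v ≡ t) → ¬ ∃ Below →
                    Σ[ v ∈ W ] (Q t → v < w × rank v ≡ t)
          case-em t (yes (v , h)) _ = v , λ _ → h
          case-em t (no ∄v)       ∄ =
            -- `w` is a placeholder: `t` turns out to lie outside `Q` in this case.
            w , λ Qt → ⊥-elim (∄ (t , Qt , λ {v} v<w eq → ∄v (v , v<w , eq)))

      rank-least : Below (rank w) × (∀ t → t ⊏ rank w → ¬ Below t)
      rank-least = subst (λ t → Below t × (∀ t′ → t′ ⊏ t → ¬ Below t′))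
                         (sym (FixPoint.unfold-wfRec <-wf (λ _ → T) step step-ext)) stepped
        where
        stepped : let t = step w (λ {v} _ → rank v) in
                  Below t × (∀ t′ → t′ ⊏ t → ¬ Below t′)
        stepped with em (∃ (Fresh w (λ {v} _ → rank v)))
        ... | yes h = proj₂ (least ⊏-wf _ h)
        ... | no ∄  = ⊥-elim (∄ fresh)

    -- The later of two points receives a value that is fresh with respect to the earlier one, so
    -- ranks do not repeat on `P`.
    rank-≼ : {P : Pred W ℓ} → (∀ {w} → P w → ¬ (Q ≼ (_< w))) → P ≼ Q
    rank-≼ {P = P} big = embedding rank (λ w Pw → proj₁ (proj₁ (rank-least (big Pw)))) injective
      where
      injective : ∀ v w → P v → P w → rank v ≡ rank w → v ≡ w
      injective v w Pv Pw eq with <-connex v w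
      ... | inj₁ v<w        = ⊥-elim (proj₂ (proj₁ (rank-least (big Pw))) v<w eq)
      ... | inj₂ (inj₁ v≡w) = v≡w
      ... | inj₂ (inj₂ w<v) = ⊥-elim (proj₂ (proj₁ (rank-least (big Pv))) w<v (sym eq))

  -- Hessenberg's theorem.  Prefixing K by ℕ makes every segment below an element
  -- of K infinite.

  module Hessenberg {K : Set a} {_<_ : Rel K r} (<-wf : WellFounded _<_) (<-connex : Connex _<_) where

    T : Set a
    T = ℕ ⊎ K

    infix 4 _≺_ _⊴_

    _≺_ : Rel T _
    _≺_ = ℕ._<_ ⊎-< _<_

    ≺-wf : WellFounded _≺_
    ≺-wf = ⊎-<-wellFounded ℕ.<-wellFounded <-wf

    ≺-connex : Connex _≺_
    ≺-connex = ⊎-connex (connex ℕ.<-cmp) <-connex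

    _⊴_ : Rel T _
    x ⊴ y = x ≺ y ⊎ x ≡ y

    -- By connexity a failure of transitivity leaves a cycle of two or three elements, which
    -- well-foundedness excludes.
    <-trans : ∀ {x y z} → x < y → y < z → x < z
    <-trans {x} {y} {z} x<y y<z with <-connex x z
    ... | inj₁ x<z         = x<z
    ... | inj₂ (inj₁ refl) = ⊥-elim (wf⇒asym <-wf x<y y<z)
    ... | inj₂ (inj₂ z<x)  = ⊥-elim (cyclic x (<-wf x) x<y y<z z<x)
      where
      cyclic : ∀ x → Acc _<_ x → ∀ {y z} → x < y → y < z → ¬ (z < x)
      cyclic x (acc rs) x<y y<z z<x = cyclic _ (rs z<x) z<x x<y y<z

    ≺-trans : ∀ {x y z} → x ≺ y → y ≺ z → x ≺ z
    ≺-trans ₁∼₂       (₂∼₂ _)   = ₁∼₂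
    ≺-trans (₁∼₁ _)   ₁∼₂       = ₁∼₂
    ≺-trans (₁∼₁ x<y) (₁∼₁ y<z) = ₁∼₁ (ℕ.<-trans x<y y<z)
    ≺-trans (₂∼₂ x<y) (₂∼₂ y<z) = ₂∼₂ (<-trans x<y y<z)

    ⊴-trans : ∀ {x y z} → x ⊴ y → y ⊴ z → x ⊴ z
    ⊴-trans (inj₁ x≺y)  (inj₁ y≺z)  = inj₁ (≺-trans x≺y y≺z)
    ⊴-trans (inj₂ refl) y⊴z         = y⊴z
    ⊴-trans (inj₁ x≺y)  (inj₂ refl) = inj₁ x≺y

    max : T × T → T
    max (x , y) with ≺-connex x y
    ... | inj₁ _ = y
    ... | inj₂ _ = x

    max-⊴ : ∀ x y → x ⊴ max (x , y) × y ⊴ max (x , y)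
    max-⊴ x y with ≺-connex x y
    ... | inj₁ x≺y         = inj₁ x≺y , inj₂ refl
    ... | inj₂ (inj₁ refl) = inj₂ refl , inj₂ refl
    ... | inj₂ (inj₂ y≺x)  = inj₂ refl , inj₁ y≺x

    max-elim : (P : Pred T p) → ∀ x y → P x → P y → P (max (x , y))
    max-elim P x y Px Py with ≺-connex x y
    ... | inj₁ _ = Py
    ... | inj₂ _ = Px

    infix 4 _<ᴳ_

    -- Gödel's well-ordering of pairs: by the maximum, then lexicographically.
    _<ᴳ_ : Rel (T × T) _
    _<ᴳ_ = ×-Lex _≡_ _≺_ (×-Lex _≡_ _≺_ _≺_) on (λ u → max u , u)

    <ᴳ-wf : WellFounded _<ᴳ_
    <ᴳ-wf = On.wellFounded _ (×-wellFounded ≺-wf (×-wellFounded ≺-wf ≺-wf))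

    <ᴳ-connex : Connex _<ᴳ_
    <ᴳ-connex u v with ×-connex ≺-connex (×-connex ≺-connex ≺-connex) (max u , u) (max v , v)
    ... | inj₁ u<v        = inj₁ u<v
    ... | inj₂ (inj₁ eq)  = inj₂ (inj₁ (cong proj₂ eq))
    ... | inj₂ (inj₂ v<u) = inj₂ (inj₂ v<u)

    <ᴳ-square : ∀ u → (_<ᴳ u) ⊆ ((_⊴ max u) ⟨×⟩ (_⊴ max u))
    <ᴳ-square u {v@(x , y)} v<u =
      ⊴-trans (proj₁ (max-⊴ x y)) (max-v⊴ v<u) , ⊴-trans (proj₂ (max-⊴ x y)) (max-v⊴ v<u)
      where
      max-v⊴ : v <ᴳ u → max v ⊴ max u
      max-v⊴ (inj₁ lt)       = inj₁ lt
      max-v⊴ (inj₂ (eq , _)) = inj₂ eq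

    -- Hilbert's hotel: the naturals move up by one, `k` takes the vacated place 0, and everything
    -- else stays.
    hotel : ∀ k → (_⊴ inj₂ k) ≼ (_≺ inj₂ k)
    hotel k = embedding f f-in λ x y _ _ → f-inj x y
      where
      g : ∀ k′ → Dec (k′ ≡ k) → T
      g k′ (yes _) = inj₁ 0
      g k′ (no _)  = inj₂ k′

      f : T → T
      f (inj₁ n)  = inj₁ (suc n)
      f (inj₂ k′) = g k′ (em _)

      f-in : ∀ x → x ⊴ inj₂ k → f x ≺ inj₂ k
      f-in (inj₁ n)  _ = ₁∼₂
      f-in (inj₂ k′) k′⊴k with em (k′ ≡ k) | k′⊴k
      ... | yes _   | _               = ₁∼₂
      ... | no _    | inj₁ k′≺k       = k′≺k
      ... | no k′≢k | inj₂ refl       = ⊥-elim (k′≢k refl)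

      f-inj : ∀ x y → f x ≡ f y → x ≡ y
      f-inj (inj₁ m)  (inj₁ n)  eq = cong inj₁ (ℕ.suc-injective (inj₁-injective eq))
      f-inj (inj₁ m)  (inj₂ k″) eq with em (k″ ≡ k)
      f-inj (inj₁ m)  (inj₂ k″) () | yes _
      f-inj (inj₁ m)  (inj₂ k″) () | no _
      f-inj (inj₂ k′) (inj₁ n)  eq with em (k′ ≡ k)
      f-inj (inj₂ k′) (inj₁ n)  () | yes _
      f-inj (inj₂ k′) (inj₁ n)  () | no _
      f-inj (inj₂ k′) (inj₂ k″) eq with em (k′ ≡ k) | em (k″ ≡ k)
      f-inj (inj₂ k′) (inj₂ k″) eq | yes refl | yes refl = refl
      f-inj (inj₂ k′) (inj₂ k″) () | yes _    | no _
      f-inj (inj₂ k′) (inj₂ k″) () | no _     | yes _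
      f-inj (inj₂ k′) (inj₂ k″) eq | no _     | no _     = eq

    -- Pigeonhole: the segment up to `n` has `suc n` elements, so its square has no room for
    -- `suc (suc n * suc n)` numbers.
    ℕ⋠finite-square : ∀ n → ¬ (U {A = ℕ} ≼ (_⊴ inj₁ n) ⟨×⟩ (_⊴ inj₁ n))
    ℕ⋠finite-square n (embedding f f-in f-inj) = ℕ.1+n≰n (Fin.injective⇒≤ {f = code} code-inj)
      where
      position : ∀ {x} → x ⊴ inj₁ n → Fin (suc n)
      position {inj₁ i} (inj₁ (₁∼₁ i<n)) = fromℕ< (ℕ.m<n⇒m<1+n i<n)
      position {inj₁ i} (inj₂ refl)      = fromℕ< (ℕ.n<1+n i)

      position-inj : ∀ {x y} (x⊴ : x ⊴ inj₁ n) (y⊴ : y ⊴ inj₁ n) → position x⊴ ≡ position y⊴ → x ≡ y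
      position-inj {inj₁ i} {inj₁ j} (inj₁ (₁∼₁ _)) (inj₁ (₁∼₁ _)) eq = cong inj₁ (Fin.fromℕ<-injective _ _ _ _ eq)
      position-inj {inj₁ i} {inj₁ j} (inj₁ (₁∼₁ _)) (inj₂ refl)    eq = cong inj₁ (Fin.fromℕ<-injective _ _ _ _ eq)
      position-inj {inj₁ i} {inj₁ j} (inj₂ refl)    (inj₁ (₁∼₁ _)) eq = cong inj₁ (Fin.fromℕ<-injective _ _ _ _ eq)
      position-inj {inj₁ i} {inj₁ j} (inj₂ refl)    (inj₂ refl)    eq = refl

      x⊴ : ∀ i → proj₁ (f i) ⊴ inj₁ n
      x⊴ i = proj₁ (f-in i _)

      y⊴ : ∀ i → proj₂ (f i) ⊴ inj₁ n
      y⊴ i = proj₂ (f-in i _)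

      code : Fin (suc (suc n * suc n)) → Fin (suc n * suc n)
      code i = combine (position (x⊴ (toℕ i))) (position (y⊴ (toℕ i)))

      code-inj : Injective _≡_ _≡_ code
      code-inj {i} {j} eq =
        let eq₁ , eq₂ = Fin.combine-injective _ _ (position (x⊴ (toℕ j))) (position (y⊴ (toℕ j))) eq
        in Fin.toℕ-injective (f-inj _ _ _ _
             (cong₂ _,_ (position-inj (x⊴ (toℕ i)) (x⊴ (toℕ j)) eq₁)
                        (position-inj (y⊴ (toℕ i)) (y⊴ (toℕ j)) eq₂)))

    -- If `P` embeds in the segment below one of its own elements, its square passes through the
    -- square of that segment. Otherwise no Gödel segment below a pair from `P` holds a copy of `P`,
    -- as it lies in a square that is finite or embeds in such a segment; so `rank` embeds the
    -- square of `P` in `P`.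
    square-step : (P : Pred T p) → (∀ n → P (inj₁ n)) →
                  (∀ k → P (inj₂ k) → (_≺ inj₂ k) ⊆ P) →
                  (∀ k → P (inj₂ k) → (_≺ inj₂ k) ⟨×⟩ (_≺ inj₂ k) ≼ (_≺ inj₂ k)) →
                  P ⟨×⟩ P ≼ P
    square-step P Pℕ P-down ih with em (∃[ k ] P (inj₂ k) × (P ≼ (_≺ inj₂ k)))
    ... | yes (k , Pk , P≼k) =
      ≼-trans (≼-square P≼k) (≼-trans (ih k Pk) (⊆⇒≼ (P-down k Pk)))
    ... | no ∄ = Rank.rank-≼ <ᴳ-wf <ᴳ-connex ≺-wf (inj₁ 0) P {P = P ⟨×⟩ P}
                   λ {u} Pu → big u (max-elim P _ _ (proj₁ Pu) (proj₂ Pu))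
      where
      big : ∀ u → P (max u) → ¬ (P ≼ (_<ᴳ u))
      big u Pμ P≼u with max u | <ᴳ-square u
      ... | inj₁ n | sq = ℕ⋠finite-square n
        (≼-trans (embedding inj₁ (λ n _ → Pℕ n) (λ _ _ _ _ → inj₁-injective))
          (≼-trans P≼u (⊆⇒≼ sq)))
      ... | inj₂ k | sq = ∄ (k , Pμ ,
        ≼-trans P≼u (≼-trans (⊆⇒≼ sq) (≼-trans (≼-square (hotel k)) (ih k Pμ))))

    segment-square : ∀ k → (_≺ inj₂ k) ⟨×⟩ (_≺ inj₂ k) ≼ (_≺ inj₂ k)
    segment-square k = go k (<-wf k)
      where
      go : ∀ k → Acc _<_ k → (_≺ inj₂ k) ⟨×⟩ (_≺ inj₂ k) ≼ (_≺ inj₂ k)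
      go k (acc rs) = square-step (_≺ inj₂ k) (λ _ → ₁∼₂) (λ _ k′≺k x≺k′ → ≺-trans x≺k′ k′≺k)
                        λ { k′ (₂∼₂ k′<k) → go k′ (rs k′<k) }

    T-square : Σ[ f ∈ (T × T → T) ] Injective _≡_ _≡_ f
    T-square =
      let embedding f _ f-inj = square-step U _ _ (λ k _ → segment-square k)
      in f , λ {x} {y} → f-inj x y _ _

    module _ (i : ℕ → K) (i-inj : Injective _≡_ _≡_ i) where

      private
        g : ∀ k → Dec (∃[ n ] i n ≡ k) → K
        g k (yes (n , _)) = i (suc (2 * n))
        g k (no _)        = k

      -- The range of `i` makes room for ℕ: the naturals take its even places, and its former
      -- occupants move to the odd ones.
      absorb : T → K
      absorb (inj₁ n) = i (2 * n)
      absorb (inj₂ k) = g k (em _)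

      absorb-injective : Injective _≡_ _≡_ absorb
      absorb-injective {inj₁ m} {inj₁ n} eq = cong inj₁ (ℕ.*-cancelˡ-≡ m n 2 (i-inj eq))
      absorb-injective {inj₁ m} {inj₂ k} eq with em (∃[ n ] i n ≡ k)
      ... | yes (n , _) = ⊥-elim (ℕ.even≢odd m n (i-inj eq))
      ... | no ∄        = ⊥-elim (∄ (_ , eq))
      absorb-injective {inj₂ k} {inj₁ m} eq with em (∃[ n ] i n ≡ k)
      ... | yes (n , _) = ⊥-elim (ℕ.even≢odd m n (i-inj (sym eq)))
      ... | no ∄        = ⊥-elim (∄ (_ , sym eq))
      absorb-injective {inj₂ k} {inj₂ l} eq with em (∃[ n ] i n ≡ k) | em (∃[ n ] i n ≡ l)
      ... | yes (m , refl) | yes (n , refl) =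
        cong (inj₂ ∘ i) (ℕ.*-cancelˡ-≡ m n 2 (ℕ.suc-injective (i-inj eq)))
      ... | yes _          | no ∄           = ⊥-elim (∄ (_ , eq))
      ... | no ∄           | yes _          = ⊥-elim (∄ (_ , sym eq))
      ... | no _           | no _           = cong inj₂ eq

      square-injection : Σ[ f ∈ (K × K → K) ] Injective _≡_ _≡_ f
      square-injection =
        let f , f-inj = T-square
        in (λ (k , l) → absorb (f (inj₂ k , inj₂ l))) ,
           λ {_} {_} eq → let eq₁ , eq₂ = ,-injective (f-inj (absorb-injective eq))
                          in cong₂ _,_ (inj₂-injective eq₁) (inj₂-injective eq₂)

  -- Bounding functions into a regular cardinal.

  module CardinalLemmas (κ : Cardinal ℓ) where
    open Cardinal κ

    <-connex : Connex _<_
    <-connex = connex (IsStrictTotalOrder.compare isStrictTotalOrder)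

    module _ (lam : Cardinal ℓ) (lam-regular : Regular lam) (lam≰κ : ¬ (∣ lam ∣ ≤ᶜ ∣ κ ∣)) where
      private
        module Λ = Cardinal lam
        module <Λ = IsStrictTotalOrder Λ.isStrictTotalOrder

        t₀ : Λ.Carrier
        t₀ = Injection.to (proj₁ lam-regular) 0

        open Rank wellFounded <-connex Λ.wellFounded t₀ (U {A = Λ.Carrier})

        big : ∀ {k} → ¬ (U {A = Λ.Carrier} ≼ (_< k))
        big (embedding f _ f-inj) = lam≰κ (record { to = f ; cong = cong f ; injective = λ {t} {t′} → f-inj t t′ _ _ })

        rank-injective : Injective _≡_ _≡_ rank
        rank-injective {k} {k′} = _≼_.injective (rank-≼ {P = U} (λ _ → big)) k k′ _ _

        -- Otherwise choosing preimages under `rank` would inject `lam` into `κ`.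
        missed : ∃[ t ] (∀ k → rank k ≢ t)
        missed = by-contradiction λ ∄ →
          let preimage : ∀ t → ∃[ k ] rank k ≡ t
              preimage t = by-contradiction λ ∄k → ∄ (t , λ k eq → ∄k (k , eq))
          in lam≰κ (record { to = proj₁ ∘ preimage ; cong = cong _
                           ; injective = λ {t} {t′} eq → trans (sym (proj₂ (preimage t)))
                                                     (trans (cong rank eq) (proj₂ (preimage t′))) })

        -- Were `rank k` larger, the missed value would have been a smaller fresh choice at `k`.
        rank<missed : ∀ k → rank k Λ.< proj₁ missed
        rank<missed k with <Λ.compare (rank k) (proj₁ missed)
        ... | tri< lt _ _ = lt
        ... | tri≈ _ eq _ = ⊥-elim (proj₂ missed k eq)
        ... | tri> _ _ gt = ⊥-elim (proj₂ (rank-least big) _ gt (_ , λ {v} _ → proj₂ missed v))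

      -- `Regular` bounds functions on segments of `lam`, so `Q` is first carried below `missed` by
      -- `rank`, and `f` is read there through a left inverse.
      bounded : ∀ {Q : Set b} (ι : Q → Carrier) → Injective _≡_ _≡_ ι →
                (f : Q → Λ.Carrier) → ∃[ u ] (∀ x → f x Λ.< u)
      bounded ι ι-inj f with em _
      ... | no empty = t₀ , λ x → ⊥-elim (empty x)
      ... | yes x₀ =
        let u , f<u = proj₂ lam-regular (proj₁ missed) (f ∘ leftInverse (rank ∘ ι) x₀)
        in u , λ x → subst (λ x → f x Λ.< u)
                       (leftInverse-∘ (rank ∘ ι) x₀ (λ eq → ι-inj (rank-injective eq)) x)
                       (f<u _ (rank<missed (ι x)))

-- Families of subsets of κ that shatter no n-set.

module Shattering (classical : Classical) {ℓ : Level} (κ δ : Cardinal ℓ) (bound : BoundsCuts κ δ)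
  (enum : ∀ n → Cardinal.Carrier κ → Cardinal.Carrier κ × Vec (Cardinal.Carrier κ) n)
  (enum-surjective : ∀ n → StrictlySurjective _≡_ (enum n)) where
  open Classical classical
  open WellOrders classical
  open Cardinal κ renaming (Carrier to K)
  open IsStrictTotalOrder isStrictTotalOrder using (compare) renaming (trans to <-trans)
  private
    Δ : Set ℓ
    Δ = Cardinal.Carrier δ

  -- A subset of K and a node of the tree of its initial segments are both
  -- words; the letter 1F marks the undefined places of a node.

  Word : Set ℓ
  Word = K → Fin 3

  infix 4 _<ˡ_

  _<ˡ_ : Rel Word ℓ
  u <ˡ v = ∃[ x ] u x Fin.< v x × (∀ y → y < x → u y ≡ v y)

  <ˡ-trans : Transitive _<ˡ_
  <ˡ-trans {u} {v} {w} (x , ux<vx , u≡v) (y , vy<wy , v≡w) with compare x y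
  ... | tri< x<y _ _  = x , subst (u x Fin.<_) (v≡w x x<y) ux<vx ,
                        λ z z<x → trans (u≡v z z<x) (v≡w z (<-trans z<x x<y))
  ... | tri≈ _ refl _ = x , Fin.<-trans {i = u x} ux<vx vy<wy ,
                        λ z z<x → trans (u≡v z z<x) (v≡w z z<x)
  ... | tri> _ _ y<x  = y , subst (Fin._< w y) (sym (u≡v y y<x)) vy<wy ,
                        λ z z<y → trans (u≡v z (<-trans z<y y<x)) (v≡w z z<y)

  <ˡ-irrefl : ∀ {u} → ¬ (u <ˡ u)
  <ˡ-irrefl {u} (x , lt , _) = Fin.<-irrefl {x = u x} refl lt

  first-difference : {A : Set} {f g : K → A} → f ≢ g → ∃[ x ] f x ≢ g x × (∀ y → y < x → f y ≡ g y)
  first-difference {f = f} {g} f≢g =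
    let x , fx≢gx , agree = least wellFounded (λ x → f x ≢ g x)
          (by-contradiction λ ∄ → f≢g (extensionality λ x → by-contradiction λ ne → ∄ (x , ne)))
    in x , fx≢gx , λ y y<x → by-contradiction (agree y y<x)

  <ˡ-compare : Trichotomous _≡_ _<ˡ_
  <ˡ-compare u v with em (u ≡ v)
  ... | yes refl = tri≈ <ˡ-irrefl refl <ˡ-irrefl
  ... | no u≢v with first-difference u≢v
  ... | x , ux≢vx , agree with Fin.<-cmp (u x) (v x)
  ... | tri< lt _ _ = let u<v = x , lt , agree in tri< u<v u≢v (λ v<u → <ˡ-irrefl (<ˡ-trans u<v v<u))
  ... | tri≈ _ eq _ = ⊥-elim (ux≢vx eq)
  ... | tri> _ _ gt = let v<u = x , gt , λ y y<x → sym (agree y y<x) in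
                      tri> (λ u<v → <ˡ-irrefl (<ˡ-trans u<v v<u)) u≢v v<u

  words : StrictTotalOrder ℓ ℓ ℓ
  words = record { isStrictTotalOrder = isStrictTotalOrderᶜ (record
    { isEquivalence = isEquivalence ; trans = <ˡ-trans ; compare = <ˡ-compare }) }

  -- The second component only separates names of the same word.

  module _ (name : K → Word) where

    nameOrder : StrictTotalOrder ℓ ℓ ℓ
    nameOrder = On.strictTotalOrder
      (×-strictTotalOrder words (record { isStrictTotalOrder = isStrictTotalOrder }))
      (λ k → name k , k)

    nameOrder-size : StrictTotalOrder.Eq.setoid nameOrder ≈ᶜ ∣ κ ∣
    nameOrder-size = record
      { to = id ; cong = proj₂
      ; bijective = (λ { refl → refl , refl }) , λ k → k , proj₂ }

    cutAt : Word → Cut nameOrder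
    cutAt u = record
      { lower = λ k → name k <ˡ u
      ; upper = λ k → ¬ (name k <ˡ u)
      ; cover = cover
      ; separated = λ {k} {l} → separated k l
      }
      where
      cover : ∀ k → name k <ˡ u ⊎ ¬ (name k <ˡ u)
      cover k with em (name k <ˡ u)
      ... | yes lt = inj₁ lt
      ... | no ≮   = inj₂ ≮
      separated : ∀ k l → name k <ˡ u → ¬ (name l <ˡ u) →
                  StrictTotalOrder._<_ nameOrder k l
      separated k l k<u l≮u with <ˡ-compare (name l) u
      ... | tri< l<u _ _  = ⊥-elim (l≮u l<u)
      ... | tri≈ _ refl _ = inj₁ k<u
      ... | tri> _ _ u<l  = inj₁ (<ˡ-trans k<u u<l)

    cutCode : Word → Δ
    cutCode u = Injection.to (bound nameOrder nameOrder-size) (cutAt u)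

    cutCode-injective : ∀ {u v} → cutCode u ≡ cutCode v → ∀ {k} → name k <ˡ u → name k <ˡ v
    cutCode-injective eq = proj₁ (proj₁ (Injection.injective (bound nameOrder nameOrder-size) eq))

  Family : Set _
  Family = Pred (K → Bool) ℓ

  -- Equal entries receive equal bits, so a shattered vector has no repetitions and stands for a set
  -- of size `n`.
  Shatters : Family → ∀ {n} → Vec K n → Set ℓ
  Shatters F {n} ws = ∀ (bs : Vec Bool n) → ∃[ f ] F f × Vec.map f ws ≡ bs

  ShattersNo : ℕ → Family → Set ℓ
  ShattersNo n F = ∀ (ws : Vec K n) → ¬ Shatters F ws

  ShattersNo-⊆ : ∀ {n F G} → G ⊆ F → ShattersNo n F → ShattersNo n G
  ShattersNo-⊆ G⊆F none ws sh = none ws λ bs → let f , Gf , eq = sh bs in f , G⊆F Gf , eq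

  -- The two values lie on either side of `1F`, so that a node falls strictly between the sets that
  -- continue it with `false` and those that continue it with `true`.
  letter : Bool → Fin 3
  letter false = 0F
  letter true  = 2F

  letter-injective : Injective _≡_ _≡_ letter
  letter-injective {false} {false} eq = refl
  letter-injective {true}  {true}  eq = refl

  letter≢1F : ∀ {b} → 1F ≢ letter b
  letter≢1F {false} ()
  letter≢1F {true}  ()

  AgreeBelow : K → Rel (K → Bool) ℓ
  AgreeBelow α f g = ∀ x → x < α → f x ≡ g x

  restrict : Family → K → (K → Bool) → Family
  restrict F α f g = F g × AgreeBelow α f g

  matching : Family → Word → Family
  matching F u g = F g × (∀ x → u x ≡ 1F ⊎ u x ≡ letter (g x))

  truncate : K → (K → Bool) → Word
  truncate α f x with em (x < α)
  ... | yes _ = letter (f x)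
  ... | no _  = 1F

  truncate-cong : ∀ {α f g} → AgreeBelow α f g → truncate α f ≡ truncate α g
  truncate-cong {α} {f} {g} agree = extensionality pointwise
    where
    pointwise : ∀ x → truncate α f x ≡ truncate α g x
    pointwise x with em (x < α)
    ... | yes x<α = cong letter (agree x x<α)
    ... | no _    = refl

  truncate-< : ∀ α f → f α ≡ true → truncate α f <ˡ letter ∘ f
  truncate-< α f fα = α , at-α , below
    where
    at-α : truncate α f α Fin.< letter (f α)
    at-α with em (α < α)
    ... | yes α<α = ⊥-elim (IsStrictTotalOrder.irrefl isStrictTotalOrder refl α<α)
    ... | no _ rewrite fα = ℕ.s≤s (ℕ.s≤s ℕ.z≤n)
    below : ∀ y → y < α → truncate α f y ≡ letter (f y)
    below y y<α with em (y < α)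
    ... | yes _ = refl
    ... | no ≮  = ⊥-elim (≮ y<α)

  truncate-> : ∀ α f → f α ≡ false → letter ∘ f <ˡ truncate α f
  truncate-> α f fα = α , at-α , below
    where
    at-α : letter (f α) Fin.< truncate α f α
    at-α with em (α < α)
    ... | yes α<α = ⊥-elim (IsStrictTotalOrder.irrefl isStrictTotalOrder refl α<α)
    ... | no _ rewrite fα = ℕ.s≤s ℕ.z≤n
    below : ∀ y → y < α → letter (f y) ≡ truncate α f y
    below y y<α with em (y < α)
    ... | yes _ = refl
    ... | no ≮  = ⊥-elim (≮ y<α)

  module _ (n : ℕ) (F : Family) where

    Thin : K → (K → Bool) → Set ℓ
    Thin α f = ShattersNo n (restrict F α f)

    Thin-cong : ∀ {α f g} → AgreeBelow α f g → Thin α f → Thin α g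
    Thin-cong agree = ShattersNo-⊆ λ (Fh , g≡h) → Fh , λ x x<α → trans (agree x x<α) (g≡h x x<α)

    Thin-mono : ∀ {α β f} → α < β → Thin α f → Thin β f
    Thin-mono α<β = ShattersNo-⊆ λ (Fh , f≡h) → Fh , λ x x<α → f≡h x (<-trans x<α α<β)

    -- By `Thin-mono` the letters `1F` fill a final segment, so this is the shortest thin initial
    -- segment of `f`, or all of `f` if none is thin.
    thinNode : (K → Bool) → Word
    thinNode f x with em (Thin x f)
    ... | yes _ = 1F
    ... | no _  = letter (f x)

    -- A node is named by its length and a vector shattered above it. If `F` shatters no set of size
    -- `suc n`, `shattered-unique` makes the choice of `f` immaterial. The constant word is a
    -- default for pairs that name nothing.
    shatteringNode : K × Vec K n → Word
    shatteringNode (α , ws) with em (∃[ f ] F f × Shatters (restrict F α f) ws)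
    ... | yes (f , _) = truncate α f
    ... | no _        = λ _ → 1F

    thickNode : K → Word
    thickNode = shatteringNode ∘ enum n

    matching-thinNode : ∀ {f} → F f → matching F (thinNode f) f
    matching-thinNode {f} Ff = Ff , matches
      where
      matches : ∀ x → thinNode f x ≡ 1F ⊎ thinNode f x ≡ letter (f x)
      matches x with em (Thin x f)
      ... | yes _ = inj₁ refl
      ... | no _  = inj₂ refl

    -- The first thin place is at most `γ`, and up to there `f` and `g` have the same initial
    -- segments; from `γ` on, both are thin.
    thinNode-cong : ∀ {γ f g} → AgreeBelow γ f g → Thin γ f → thinNode f ≡ thinNode g
    thinNode-cong {γ} {f} {g} agree thin = extensionality pointwise
      where
      thin-g : Thin γ g
      thin-g = Thin-cong agree thin
      pointwise : ∀ x → thinNode f x ≡ thinNode g x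
      pointwise x with compare x γ | em (Thin x f) | em (Thin x g)
      ... | _             | yes _    | yes _    = refl
      ... | tri< x<γ _ _  | no _     | no _     = cong letter (agree x x<γ)
      ... | tri< x<γ _ _  | yes tf   | no ¬tg   =
        ⊥-elim (¬tg (Thin-cong (λ y y<x → agree y (<-trans y<x x<γ)) tf))
      ... | tri< x<γ _ _  | no ¬tf   | yes tg   =
        ⊥-elim (¬tf (Thin-cong (λ y y<x → sym (agree y (<-trans y<x x<γ))) tg))
      ... | tri≈ _ refl _ | no ¬tf   | _        = ⊥-elim (¬tf thin)
      ... | tri≈ _ refl _ | _        | no ¬tg   = ⊥-elim (¬tg thin-g)
      ... | tri> _ _ γ<x  | no ¬tf   | _        = ⊥-elim (¬tf (Thin-mono γ<x thin))
      ... | tri> _ _ γ<x  | _        | no ¬tg   = ⊥-elim (¬tg (Thin-mono γ<x thin-g))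

    -- The node spells out `f` below its first thin place `α`, so every matching member extends that
    -- thin segment.
    matching-thin : ∀ {γ f} → Thin γ f → ShattersNo n (matching F (thinNode f))
    matching-thin {γ} {f} thin with least wellFounded (λ α → Thin α f) (γ , thin)
    ... | α , thin-α , thick = ShattersNo-⊆ (λ {g} (Fg , m) → Fg , λ x x<α → agrees g x (thick x x<α) (m x)) thin-α
      where
      agrees : ∀ g x → ¬ Thin x f → thinNode f x ≡ 1F ⊎ thinNode f x ≡ letter (g x) → f x ≡ g x
      agrees g x ¬thin m with em (Thin x f) | m
      ... | yes tx | _       = ⊥-elim (¬thin tx)
      ... | no _   | inj₁ eq = ⊥-elim (letter≢1F (sym eq))
      ... | no _   | inj₂ eq = letter-injective eq

    -- Otherwise a place where f and g differ could be added to ws.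

    shattered-unique : ShattersNo (suc n) F → ∀ {α f g ws} → Shatters (restrict F α f) ws →
                       Shatters (restrict F α g) ws → AgreeBelow α f g
    shattered-unique none {α} {f} {g} {ws} sh-f sh-g x x<α = by-contradiction λ fx≢gx →
      none (x ∷ ws) λ { (b ∷ bs) → extend fx≢gx b bs }
      where
      pick : ∀ h → Shatters (restrict F α h) ws → ∀ b bs → h x ≡ b →
             ∃[ f ] F f × Vec.map f (x ∷ ws) ≡ b ∷ bs
      pick h sh b bs hx≡b =
        let h′ , (Fh′ , agree) , eq = sh bs
        in h′ , Fh′ , cong₂ _∷_ (trans (sym (agree x x<α)) hx≡b) eq
      extend : f x ≢ g x → ∀ b bs → ∃[ f ] F f × Vec.map f (x ∷ ws) ≡ b ∷ bs
      extend fx≢gx b bs with f x Bool.≟ b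
      ... | yes fx≡b = pick f sh-f b bs fx≡b
      ... | no fx≢b  = pick g sh-g b bs (trans (Bool.¬-not (fx≢gx ∘ sym)) (sym (Bool.¬-not (fx≢b ∘ sym))))

    -- Above a thick segment some `ws` is shattered. At the index of `(γ , ws)` the node may come
    -- from another member of `F`, but by `shattered-unique` that member agrees with `f` below `γ`.
    thickNode-hit : ShattersNo (suc n) F → ∀ {γ f} → F f → ¬ Thin γ f →
                    ∃[ k ] thickNode k ≡ truncate γ f
    thickNode-hit none {γ} {f} Ff thick =
      let k , eq = enum-surjective n (γ , proj₁ shattered)
      in k , trans (cong shatteringNode eq) (named (proj₂ shattered))
      where
      shattered : ∃[ ws ] Shatters (restrict F γ f) {n} ws
      shattered = by-contradiction λ ∄ → thick λ ws sh → ∄ (ws , sh)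
      named : ∀ {ws} → Shatters (restrict F γ f) ws → shatteringNode (γ , ws) ≡ truncate γ f
      named {ws} sh with em (∃[ g ] F g × Shatters (restrict F γ g) ws)
      ... | yes (g , _ , sh′) = truncate-cong (shattered-unique none sh′ sh)
      ... | no ∄              = ⊥-elim (∄ (f , Ff , sh))

  -- The cut of f separates it from the sets that leave it at a thick node.  The
  -- others share its first thin node, whose family is coded by recursion.

  code : ℕ → Family → (K → Bool) → ℕ → Δ
  code zero    F f i       = cutCode (λ _ _ → 1F) (λ _ → 1F)
  code (suc n) F f zero    = cutCode (thickNode n F) (letter ∘ f)
  code (suc n) F f (suc i) = code n (matching F (thinNode n F f)) f i

  -- Consider the first place where `f` and `g` differ. If their common segment is thin, they share
  -- their thin node, and the induction hypothesis applies to the family matching it. If it is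
  -- thick, it has a name, and this name separates their cuts.
  code-injective : ∀ n F → ShattersNo n F → ∀ {f g} → F f → F g → code n F f ≗ code n F g → f ≡ g
  -- Any member of `F` would shatter the empty vector, so `F` is empty here.
  code-injective zero F none {f} Ff Fg eq = ⊥-elim (none [] λ { [] → f , Ff , refl })
  code-injective (suc n) F none {f} {g} Ff Fg eq = by-contradiction λ f≢g →
    let γ , fγ≢gγ , agree = first-difference f≢g in differ f≢g γ fγ≢gγ agree (em (Thin n F γ f))
    where
    -- The common node lies below `f` and above `g`, hence in the lower part of the cut of `f` only.
    thick-differ : ∀ {f g} γ → F f → AgreeBelow γ f g → ¬ Thin n F γ f → f γ ≡ true → g γ ≡ false →
                   code (suc n) F f zero ≢ code (suc n) F g zero
    thick-differ {f} {g} γ Ff agree thick fγ gγ eq =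
      let k , name≡ = thickNode-hit n F none Ff thick
          name<f = subst (_<ˡ letter ∘ f) (sym name≡) (truncate-< γ f fγ)
          name<g = cutCode-injective (thickNode n F) eq name<f
          g<name = subst (letter ∘ g <ˡ_) (trans (truncate-cong (λ x x<γ → sym (agree x x<γ))) (sym name≡))
                         (truncate-> γ g gγ)
      in <ˡ-irrefl (<ˡ-trans name<g g<name)

    differ : f ≢ g → ∀ γ → f γ ≢ g γ → AgreeBelow γ f g → ¬ Dec (Thin n F γ f)
    differ f≢g γ fγ≢gγ agree (yes thin) = f≢g
      (code-injective n (matching F (thinNode n F f)) (matching-thin n F thin)
        (matching-thinNode n F Ff)
        (subst (λ u → matching F u g) (sym node≡) (matching-thinNode n F Fg))
        (λ i → trans (eq (suc i)) (cong (λ u → code n (matching F u) g i) (sym node≡))))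
      where
      node≡ : thinNode n F f ≡ thinNode n F g
      node≡ = thinNode-cong n F agree thin
    differ f≢g γ fγ≢gγ agree (no thick) with f γ in fγ | g γ in gγ
    ... | true  | true  = fγ≢gγ refl
    ... | false | false = fγ≢gγ refl
    ... | true  | false = thick-differ γ Ff agree thick fγ gγ (eq zero)
    ... | false | true  = thick-differ γ Fg agree′ (thick ∘ Thin-cong n F agree′) gγ fγ (sym (eq zero))
      where
      agree′ : AgreeBelow γ g f
      agree′ x x<γ = sym (agree x x<γ)

-- Renaming of variables and blocks of quantifiers.

Renaming : {S : Set ℓ} → List S → List S → Set ℓ
Renaming Γ Δ = ∀ {s} → s ∈ Γ → s ∈ Δ

lift∈ : {S : Set ℓ} {Γ Δ : List S} {s : S} → Renaming Γ Δ → Renaming (s ∷ Γ) (s ∷ Δ)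
lift∈ ρ (here eq) = here eq
lift∈ ρ (there v) = there (ρ v)

module _ {L : Language ℓ} where
  open Language L

  private
    variable
      Γ Δ : Ctx L
      s   : Sort

  renameTerm  : Renaming Γ Δ → Term L Γ s → Term L Δ s
  renameTerms : ∀ {ss} → Renaming Γ Δ → All (Term L Γ) ss → All (Term L Δ) ss
  renameTerm ρ (var v)    = var (ρ v)
  renameTerm ρ (app f ts) = app f (renameTerms ρ ts)
  renameTerms ρ []       = []
  renameTerms ρ (t ∷ ts) = renameTerm ρ t ∷ renameTerms ρ ts

  rename : Renaming Γ Δ → Formula L Γ → Formula L Δ
  rename ρ ⊥̇          = ⊥̇
  rename ρ (t ≈̇ u)    = renameTerm ρ t ≈̇ renameTerm ρ u
  rename ρ (rel R ts) = rel R (renameTerms ρ ts)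
  rename ρ (φ ⇒̇ ψ)    = rename ρ φ ⇒̇ rename ρ ψ
  rename ρ (∀̇ s φ)    = ∀̇ s (rename (lift∈ ρ) φ)

  ∀̇* : ∀ Γ → Formula L (Γ ++ Δ) → Formula L Δ
  ∀̇* []      φ = φ
  ∀̇* (s ∷ Γ) φ = ∀̇* Γ (∀̇ s φ)

Signed : Bool → Set a → Set a
Signed true  A = A
Signed false A = ¬ A

signed-dec : ∀ {P : Set a} {A : Set r} (d : Dec P) → Signed (does d) A → A ⇔ P
signed-dec (yes p) h  = mk⇔ (const p) (const h)
signed-dec (no ¬p) ¬h = mk⇔ (⊥-elim ∘ ¬h) (⊥-elim ∘ ¬p)

-- Definable relations.

module Definability (classical : Classical) {L : Language ℓ} (M : Structure L) where
  open Classical classical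
  open WellOrders classical
  open Language L
  open Structure M

  private
    variable
      Γ Δ Θ : Ctx L
      s     : Sort
      X     : Set a

  lookup-++ˡ : (d : Tuple M Γ) (e : Tuple M Δ) (v : s ∈ Γ) →
               All.lookup (++⁺ d e) (∈-++⁺ˡ v) ≡ All.lookup d v
  lookup-++ˡ (_ ∷ d) e (here refl) = refl
  lookup-++ˡ (_ ∷ d) e (there v)   = lookup-++ˡ d e v

  lookup-++ʳ : (d : Tuple M Γ) (e : Tuple M Δ) (v : s ∈ Δ) →
               All.lookup (++⁺ d e) (∈-++⁺ʳ Γ v) ≡ All.lookup e v
  lookup-++ʳ []      e v = refl
  lookup-++ʳ (_ ∷ d) e v = lookup-++ʳ d e v

  lookup-++⁻ : (d : Tuple M Γ) (e : Tuple M Δ) (v : s ∈ Γ ++ Δ) →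
               [ All.lookup d , All.lookup e ]′ (∈-++⁻ Γ v) ≡ All.lookup (++⁺ d e) v
  lookup-++⁻ []      e v           = refl
  lookup-++⁻ (_ ∷ d) e (here refl) = refl
  lookup-++⁻ {Γ = _ ∷ Γ} (_ ∷ d) e (there v) with ∈-++⁻ Γ v | lookup-++⁻ d e v
  ... | inj₁ _ | eq = eq
  ... | inj₂ _ | eq = eq

  Renames : Renaming Γ Δ → Tuple M Δ → Tuple M Γ → Set ℓ
  Renames {Γ} ρ e d = ∀ {s} (v : s ∈ Γ) → All.lookup e (ρ v) ≡ All.lookup d v

  eval-rename  : (ρ : Renaming Γ Δ) (e : Tuple M Δ) (d : Tuple M Γ) → Renames ρ e d →
                 (t : Term L Γ s) → eval M e (renameTerm ρ t) ≡ eval M d t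
  evals-rename : ∀ {ss} (ρ : Renaming Γ Δ) (e : Tuple M Δ) (d : Tuple M Γ) → Renames ρ e d →
                 (ts : All (Term L Γ) ss) → evals M e (renameTerms ρ ts) ≡ evals M d ts
  eval-rename ρ e d ren (var v) = ren v
  eval-rename ρ e d ren (app f ts) = cong (fun f) (evals-rename ρ e d ren ts)
  evals-rename ρ e d ren [] = refl
  evals-rename ρ e d ren (t ∷ ts) =
    cong₂ _∷_ (eval-rename ρ e d ren t) (evals-rename ρ e d ren ts)

  lift-renames : (ρ : Renaming Γ Δ) (e : Tuple M Δ) (d : Tuple M Γ) → Renames ρ e d →
                 (m : Carrier s) → Renames (lift∈ ρ) (m ∷ e) (m ∷ d)
  lift-renames ρ e d ren m (here refl) = refl
  lift-renames ρ e d ren m (there v)   = ren v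

  ⊨-rename : (ρ : Renaming Γ Δ) (e : Tuple M Δ) (d : Tuple M Γ) → Renames ρ e d →
             (φ : Formula L Γ) → (M ⊨ rename ρ φ [ e ]) ⇔ (M ⊨ φ [ d ])
  ⊨-rename ρ e d ren ⊥̇ = mk⇔ id id
  ⊨-rename ρ e d ren (t ≈̇ u)
    rewrite eval-rename ρ e d ren t | eval-rename ρ e d ren u = mk⇔ id id
  ⊨-rename ρ e d ren (rel R ts) rewrite evals-rename ρ e d ren ts = mk⇔ id id
  ⊨-rename ρ e d ren (φ ⇒̇ ψ) =
    let φ⇔ = ⊨-rename ρ e d ren φ ; ψ⇔ = ⊨-rename ρ e d ren ψ
    in mk⇔ (λ f → to ψ⇔ ∘ f ∘ from φ⇔) (λ f → from ψ⇔ ∘ f ∘ to φ⇔)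
  ⊨-rename ρ e d ren (∀̇ s φ) =
    let φ⇔ = λ m → ⊨-rename (lift∈ ρ) (m ∷ e) (m ∷ d) (lift-renames ρ e d ren m) φ
    in mk⇔ (λ f m → to (φ⇔ m) (f m)) (λ f m → from (φ⇔ m) (f m))

  ⊨-∀̇* : ∀ Γ (φ : Formula L (Γ ++ Δ)) {e : Tuple M Δ} →
         (M ⊨ ∀̇* Γ φ [ e ]) ⇔ (∀ (d : Tuple M Γ) → M ⊨ φ [ ++⁺ d e ])
  ⊨-∀̇* []      φ = mk⇔ (λ { h [] → h }) (λ h → h [])
  ⊨-∀̇* (s ∷ Γ) φ = let φ⇔ = ⊨-∀̇* Γ (∀̇ s φ) in
    mk⇔ (λ { h (m ∷ d) → to φ⇔ h d m }) (λ h → from φ⇔ λ d m → h (m ∷ d))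

  ⊆-++ : ∀ {Γ Δ A} {d : Tuple M Γ} {e : Tuple M Δ} → _⊆ᴾ_ M d A → _⊆ᴾ_ M e A → _⊆ᴾ_ M (++⁺ d e) A
  ⊆-++ {Γ} {A = A} {d} {e} d⊆A e⊆A {s} v = subst (A s) (lookup-++⁻ d e v) (cases (∈-++⁻ Γ v))
    where
    cases : ∀ v → A s ([ All.lookup d , All.lookup e ]′ v)
    cases (inj₁ v) = d⊆A v
    cases (inj₂ v) = e⊆A v

  ⊆-join : ∀ {Γ A n} {d : Fin n → Tuple M Γ} → (∀ p → _⊆ᴾ_ M (d p) A) → _⊆ᴾ_ M (join M n d) A
  ⊆-join {n = zero}  d⊆A ()
  ⊆-join {A = A} {n = suc n} {d = d} d⊆A =
    ⊆-++ {A = A} {d = d Fin.zero} (d⊆A Fin.zero) (⊆-join {A = A} {d = d ∘ Fin.suc} (d⊆A ∘ Fin.suc))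

  -- The tuple f x consists of entries of the tuple env x, in positions not
  -- depending on x.

  record Selects {X : Set a} (env : X → Tuple M Γ) (f : X → Tuple M Δ) : Set (a ⊔ ℓ) where
    constructor selects
    field
      ρ      : Renaming Δ Γ
      select : ∀ x → Renames ρ (env x) (f x)

  sel-trans : {f : X → Tuple M Γ} {g : X → Tuple M Δ} {h : X → Tuple M Θ} →
              Selects f g → Selects g h → Selects f h
  sel-trans (selects ρ₁ sel₁) (selects ρ₂ sel₂) =
    selects (ρ₁ ∘ ρ₂) λ x v → trans (sel₁ x (ρ₂ v)) (sel₂ x v)

  sel-left : {f : X → Tuple M Γ} {g : X → Tuple M Δ} → Selects (λ x → ++⁺ (f x) (g x)) f
  sel-left {f = f} {g} = selects ∈-++⁺ˡ λ x → lookup-++ˡ (f x) (g x)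

  sel-right : {f : X → Tuple M Γ} {g : X → Tuple M Δ} → Selects (λ x → ++⁺ (f x) (g x)) g
  sel-right {Γ = Γ} {f = f} {g = g} = selects (∈-++⁺ʳ Γ) λ x → lookup-++ʳ (f x) (g x)

  sel-[] : {f : X → Tuple M Γ} → Selects f (λ _ → [])
  sel-[] = selects (λ ()) λ _ ()

  sel-++ : {f : X → Tuple M Θ} {g : X → Tuple M Γ} {h : X → Tuple M Δ} →
           Selects f g → Selects f h → Selects f (λ x → ++⁺ (g x) (h x))
  sel-++ {Θ = Θ} {Γ = Γ} {Δ = Δ} {f = f} {g} {h} (selects ρ₁ sel₁) (selects ρ₂ sel₂) =
    selects ([ ρ₁ , ρ₂ ]′ ∘ ∈-++⁻ Γ) λ x v →
      trans (cases x (∈-++⁻ Γ v)) (lookup-++⁻ (g x) (h x) v)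
    where
    cases : ∀ x {s} (v : s ∈ Γ ⊎ s ∈ Δ) → All.lookup (f x) ([ ρ₁ , ρ₂ ]′ v) ≡
            [ All.lookup (g x) , All.lookup (h x) ]′ v
    cases x (inj₁ v) = sel₁ x v
    cases x (inj₂ v) = sel₂ x v

  sel-component : ∀ {n} {f : X → Fin n → Tuple M Γ} p → Selects (λ x → join M n (f x)) (λ x → f x p)
  sel-component Fin.zero    = sel-left
  sel-component (Fin.suc p) = sel-trans sel-right (sel-component p)

  sel-join : ∀ {n} {f : X → Tuple M Γ} {g : X → Fin n → Tuple M Δ} →
             (∀ p → Selects f (λ x → g x p)) → Selects f (λ x → join M n (g x))
  sel-join {n = zero}  sel = sel-[]
  sel-join {n = suc n} sel = sel-++ (sel Fin.zero) (sel-join (sel ∘ Fin.suc))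

  -- One formula serves all `x`. The closure lemmas below build it from the shape of `R`, so that
  -- formulas need not be written out with their variables.
  record Definable {X : Set a} (env : X → Tuple M Γ) (R : X → Set r) : Set (a ⊔ r ⊔ ℓ) where
    constructor definable
    field
      formula : Formula L Γ
      correct : ∀ x → (M ⊨ formula [ env x ]) ⇔ R x

  private
    variable
      env : X → Tuple M Γ
      R Q : X → Set r

  def-⊨ : {env : X → Tuple M Γ} {f : X → Tuple M Δ} →
          Selects env f → (φ : Formula L Δ) → Definable env (λ x → M ⊨ φ [ f x ])
  def-⊨ (selects ρ sel) φ = definable (rename ρ φ) λ x → ⊨-rename ρ _ _ (sel x) φ

  def-⇔ : (∀ x → R x ⇔ Q x) → Definable env R → Definable env Q
  def-⇔ R⇔Q (definable φ φ⇔) = definable φ λ x → R⇔Q x ⇔-∘ φ⇔ x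

  def-→ : Definable env R → Definable env Q → Definable env (λ x → R x → Q x)
  def-→ (definable φ φ⇔) (definable ψ ψ⇔) = definable (φ ⇒̇ ψ) λ x →
    mk⇔ (λ h → to (ψ⇔ x) ∘ h ∘ from (φ⇔ x)) (λ h → from (ψ⇔ x) ∘ h ∘ to (φ⇔ x))

  def-¬ : Definable env R → Definable env (λ x → ¬ R x)
  def-¬ (definable φ φ⇔) = definable (φ ⇒̇ ⊥̇) λ x →
    mk⇔ (λ h → lower ∘ h ∘ from (φ⇔ x)) (λ h → lift ∘ h ∘ to (φ⇔ x))

  -- Implication and falsity are the propositional connectives at hand, so the conjunction is
  -- expressed as the negation of `R x → ¬ Q x`.
  def-× : Definable env R → Definable env Q → Definable env (λ x → R x × Q x)
  def-× R-def Q-def = def-⇔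
    (λ x → mk⇔ (λ h → by-contradiction λ ¬RQ → h λ Rx Qx → ¬RQ (Rx , Qx))
               (λ (Rx , Qx) h → h Rx Qx))
    (def-¬ (def-→ R-def (def-¬ Q-def)))

  def-signed : ∀ b → Definable env R → Definable env (λ x → Signed b (R x))
  def-signed true  R-def = R-def
  def-signed false R-def = def-¬ R-def

  def-∃ : {env : X → Tuple M Γ} {R : X → Tuple M Δ → Set r} →
          Definable (λ (x , d) → ++⁺ d (env x)) (λ (x , d) → R x d) →
          Definable env (λ x → ∃ (R x))
  def-∃ {Δ = Δ} R-def with def-¬ R-def
  ... | definable φ φ⇔ = def-⇔
    (λ x → mk⇔ (λ h → by-contradiction λ ∄ → h (from (⊨-∀̇* Δ φ) λ d → from (φ⇔ (x , d)) λ Rxd → ∄ (d , Rxd)))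
               (λ (d , Rxd) h → to (φ⇔ (x , d)) (to (⊨-∀̇* Δ φ) h d) Rxd))
    (def-¬ (definable (∀̇* Δ φ) λ x → mk⇔ id id))

  def-∀Fin : ∀ {n} {R : Fin n → X → Set r} → (∀ p → Definable env (R p)) → Definable env (λ x → ∀ p → R p x)
  def-∀Fin {n = zero}  R-def = definable (⊥̇ ⇒̇ ⊥̇) λ x → mk⇔ (λ _ ()) (λ _ → id)
  def-∀Fin {n = suc n} R-def = def-⇔
    (λ x → mk⇔ (λ { (h , hs) Fin.zero → h ; (h , hs) (Fin.suc p) → hs p }) (λ h → h Fin.zero , h ∘ Fin.suc))
    (def-× (R-def Fin.zero) (def-∀Fin (R-def ∘ Fin.suc)))

  def-∀Bool : {R : Bool → X → Set r} → (∀ b → Definable env (R b)) → Definable env (λ x → ∀ b → R b x)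
  def-∀Bool R-def = def-⇔
    (λ x → mk⇔ (λ { (h , h′) true → h ; (h , h′) false → h′ }) (λ h → h true , h false))
    (def-× (R-def true) (R-def false))

  -- A finite conjunction. Abstracting from the way to quantify over `A` lets the lemma be iterated,
  -- down to bit matrices.
  def-∀Vec : {A : Set} {X : Set a} {env : X → Tuple M Γ} →
             (∀ {R : A → X → Set r} → (∀ a → Definable env (R a)) → Definable env (λ x → ∀ a → R a x)) →
             ∀ {n} {R : Vec A n → X → Set r} →
             (∀ v → Definable env (R v)) → Definable env (λ x → ∀ v → R v x)
  def-∀Vec ∀A {zero}  R-def = def-⇔ (λ x → mk⇔ (λ { h [] → h }) (λ h → h [])) (R-def [])
  def-∀Vec ∀A {suc n} R-def = def-⇔
    (λ x → mk⇔ (λ { h (a ∷ v) → h a v }) (λ h a v → h (a ∷ v)))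
    (∀A λ a → def-∀Vec ∀A λ v → R-def (a ∷ v))

  -- Saturation over countably many parameters.

  entries : (ℕ → Tuple M Γ) → Params M
  entries {Γ} d s m = ∃[ n ] Σ[ v ∈ s ∈ Γ ] All.lookup (d n) v ≡ m

  index-injective : ∀ {s s′} (e : Tuple M Γ) (v : s ∈ Γ) (v′ : s′ ∈ Γ) → index v ≡ index v′ →
                    _≡_ {A = ∃ Carrier} (s , All.lookup e v) (s′ , All.lookup e v′)
  index-injective (m ∷ e) (here refl) (here refl) eq = refl
  index-injective (m ∷ e) (there v)   (there v′)  eq = index-injective e v v′ (Fin.suc-injective eq)

  module _ (κ θ : Cardinal ℓ) (κ<θ : ∣ κ ∣ <ᶜ ∣ θ ∣) (κ-infinite : Infinite κ) where

    private
      K = Cardinal.Carrier κ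
      num : ℕ → K
      num = Injection.to κ-infinite
      square : Σ[ f ∈ (K × K → K) ] Injective _≡_ _≡_ f
      square = Hessenberg.square-injection (Cardinal.wellFounded κ) (CardinalLemmas.<-connex κ)
                 num (Injection.injective κ-infinite)
      pair = proj₁ square

    -- An entry is coded by the number of a tuple and a position in it. They are chosen from the
    -- entry alone, because the setoid of parameters ignores membership proofs.
    entries-≤ : (d : ℕ → Tuple M Γ) → ∣_∣ᴾ M (entries d) ≤ᶜ ∣ κ ∣
    entries-≤ {Γ} d = record
      { to        = λ (s , m , _) → position (s , m) (em _)
      ; cong      = λ { refl → refl }
      ; injective = λ { {s , m , h} {s′ , m′ , h′} eq → position-injective h h′ (em _) (em _) eq }
      }
      where
      Entry : ∃ Carrier → Set ℓ
      Entry (s , m) = entries d s m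

      position : ∀ sm → Dec (Entry sm) → K
      position sm (yes (n , v , _)) = pair (num n , num (toℕ (index v)))
      position sm (no _)            = num 0

      position-injective : ∀ {sm sm′} → Entry sm → Entry sm′ → (dec : Dec (Entry sm)) (dec′ : Dec (Entry sm′)) →
                           position sm dec ≡ position sm′ dec′ → sm ≡ sm′
      position-injective h h′ (no ∄) _       eq = ⊥-elim (∄ h)
      position-injective h h′ (yes _) (no ∄) eq = ⊥-elim (∄ h′)
      position-injective _ _ (yes (n , v , refl)) (yes (n′ , v′ , refl)) eq
        with ,-injective (proj₂ square eq)
      ... | n≡ , v≡ with Injection.injective κ-infinite n≡
      ... | refl = index-injective (d n) v v′ (Fin.toℕ-injective (Injection.injective κ-infinite v≡))

    entries-small : (d : ℕ → Tuple M Γ) → ∣_∣ᴾ M (entries d) <ᶜ ∣ θ ∣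
    entries-small d = injection-∘ (entries-≤ d) (proj₁ κ<θ) , λ θ≤A → proj₂ κ<θ (injection-∘ θ≤A (entries-≤ d))

  descending-≤ : {X : Set a} (R : ℕ → X → Set r) → (∀ n x → R (suc n) x → R n x) →
                 ∀ {m n} → m ℕ.≤′ n → ∀ x → R n x → R m x
  descending-≤ R desc (ℕ.≤′-reflexive refl) x Rnx = Rnx
  descending-≤ R desc (ℕ.≤′-step m≤n)       x Rnx = descending-≤ R desc m≤n x (desc _ x Rnx)

  -- The conditions decrease, so finitely many of them follow from one with a large enough index,
  -- and this one is satisfiable.
  realize : ∀ {θ : Cardinal ℓ} → Saturated M θ → {A : Params M} → ∣_∣ᴾ M A <ᶜ ∣ θ ∣ →
            (R : ℕ → Tuple M Δ → Set ℓ) (ψ : ℕ → FormulaOver M A Δ) →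
            (∀ n e → tp M A e (ψ n) ⇔ R n e) →
            (∀ n e → R (suc n) e → R n e) → (∀ n → ∃ (R n)) → ∃[ e ] (∀ n → R n e)
  realize {Δ = Δ} sat {A} small R ψ ψ⇔R desc inhabited =
    let e , realized = sat A small Δ (λ χ → ∃[ n ] ψ n ≡ χ) λ ψs ψs∈ →
          let n , below = common ψs ψs∈ ; e , Rne = inhabited n in e , below e Rne
    in e , λ n → to (ψ⇔R n e) (realized (n , refl))
    where
    common : ∀ ψs → All (λ χ → ∃[ n ] ψ n ≡ χ) ψs → ∃[ n ] (∀ e → R n e → All (tp M A e) ψs)
    common []       []                  = 0 , λ _ _ → []
    common (_ ∷ ψs) ((m , refl) ∷ ψs∈) =
      let n , below = common ψs ψs∈
      in m ℕ.⊔ n , λ e Re →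
           from (ψ⇔R m e) (descending-≤ R desc (ℕ.≤⇒≤′ (ℕ.m≤m⊔n m n)) e Re)
           ∷ below e (descending-≤ R desc (ℕ.≤⇒≤′ (ℕ.m≤n⊔m m n)) e Re)

-- Positions in finite vectors.

lookup-∷ʳ : {A : Set a} → ∀ {n} (xs : Vec A n) (x : A) i → lookup (xs Vec.∷ʳ x) (inject₁ i) ≡ lookup xs i
lookup-∷ʳ (_ ∷ xs) x Fin.zero    = refl
lookup-∷ʳ (_ ∷ xs) x (Fin.suc i) = lookup-∷ʳ xs x i

nth : {A : Set a} → ∀ {n} → Vec A n → A → ℕ → A
nth []       x₀ _       = x₀
nth (x ∷ xs) x₀ zero    = x
nth (x ∷ xs) x₀ (suc k) = nth xs x₀ k

nth-lookup : {A : Set a} → ∀ {n} (xs : Vec A n) (x₀ : A) i → nth xs x₀ (toℕ i) ≡ lookup xs i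
nth-lookup (x ∷ xs) x₀ Fin.zero    = refl
nth-lookup (x ∷ xs) x₀ (Fin.suc i) = nth-lookup xs x₀ i

-- Vectors will grow at the front, so position `p` in a vector of length N holds the tuple added at
-- stage N - 1 - p.
descend : ∀ {N} → Fin N → ℕ
descend {suc N} Fin.zero    = N
descend {suc N} (Fin.suc p) = descend p

descend-surjective : ∀ {N n} → n ℕ.<′ N → ∃[ p ] descend {N} p ≡ n
descend-surjective (ℕ.≤′-reflexive refl) = Fin.zero , refl
descend-surjective (ℕ.≤′-step n<N)       = let p , eq = descend-surjective n<N in Fin.suc p , eq

-- From shattering by all tails to the failure of 2-dependence.

module Independence (classical : Classical) {L : Language ℓ} (M : Structure L)
  {z u w : Ctx L} (φ : Formula L (z ++ (u ++ w))) where
  open Classical classical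
  open WellOrders classical
  open Definability classical M

  Holds : Tuple M z → Tuple M u → Tuple M w → Set ℓ
  Holds B Y e = M ⊨ φ [ ++⁺ B (++⁺ Y e) ]

  def-Holds : ∀ {X : Set a} {Γ} {env : X → Tuple M Γ} {B Y e} →
              Selects env B → Selects env Y → Selects env e →
              Definable env (λ x → Holds (B x) (Y x) (e x))
  def-Holds selB selY sele = def-⊨ (sel-++ selB (sel-++ selY sele)) φ

  -- `E` is the adjacency matrix of a bipartite graph between `B` and `V`, which `e` induces through
  -- φ.
  Realizes : ∀ {N l} → Vec (Vec Bool l) N → (Fin N → Tuple M z) → Vec (Tuple M u) l → Tuple M w → Set ℓ
  Realizes E B V e = ∀ q p → Signed (lookup (lookup E q) p) (Holds (B q) (lookup V p) e)

  Realizable : ∀ {N l} → Vec (Vec Bool l) N → (Fin N → Tuple M z) → Vec (Tuple M u) l → Set ℓ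
  Realizable E B V = ∃ (Realizes E B V)

  -- For a given n this is expressed by a single formula, so that saturation can
  -- build an infinite sequence V one tuple at a time.

  Full : ∀ {N l} → (Fin N → Tuple M z) → Vec (Tuple M u) l → Set ℓ
  Full B V = ∀ E → Realizable E B V

  Extendable : ℕ → ∀ {N l} → (Fin N → Tuple M z) → Vec (Tuple M u) l → Set ℓ
  Extendable zero    B V = Full B V
  Extendable (suc n) B V = ∃[ Y ] Extendable n B (Y ∷ V)

  weaken : ∀ {X : Set a} {Γ Δ Θ : Ctx L} {env : X → Tuple M Γ} {f : X → Tuple M Θ} → Selects env f →
           Selects {X = X × Tuple M Δ} (λ (x , d) → ++⁺ d (env x)) (λ (x , d) → f x)
  weaken {env = env} (selects ρ sel) =
    sel-trans {g = λ (x , _) → env x} (sel-right {f = proj₂}) (selects ρ λ (x , _) → sel x)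

  def-Realizes : ∀ {X : Set a} {Γ} {env : X → Tuple M Γ} {N l} (E : Vec (Vec Bool l) N)
                 (B : X → Fin N → Tuple M z) (V : X → Vec (Tuple M u) l) {e} →
                 (∀ q → Selects env (λ x → B x q)) → (∀ p → Selects env (λ x → lookup (V x) p)) →
                 Selects env e → Definable env (λ x → Realizes E (B x) (V x) (e x))
  def-Realizes E B V selB selV sele = def-∀Fin λ q → def-∀Fin λ p →
    def-signed (lookup (lookup E q) p) (def-Holds (selB q) (selV p) sele)

  def-Realizable : ∀ {X : Set a} {Γ} {env : X → Tuple M Γ} {N l} (E : Vec (Vec Bool l) N)
                   (B : X → Fin N → Tuple M z) (V : X → Vec (Tuple M u) l) →
                   (∀ q → Selects env (λ x → B x q)) → (∀ p → Selects env (λ x → lookup (V x) p)) →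
                   Definable env (λ x → Realizable E (B x) (V x))
  def-Realizable {env = env} E B V selB selV =
    def-∃ (def-Realizes E (B ∘ proj₁) (V ∘ proj₁) (weaken ∘ selB) (weaken ∘ selV)
            (sel-left {f = proj₂} {g = env ∘ proj₁}))

  def-Extendable : ∀ n {X : Set a} {Γ} {env : X → Tuple M Γ} {N l} (B : X → Fin N → Tuple M z)
                   (V : X → Vec (Tuple M u) l) →
                   (∀ q → Selects env (λ x → B x q)) → (∀ p → Selects env (λ x → lookup (V x) p)) →
                   Definable env (λ x → Extendable n (B x) (V x))
  def-Extendable zero B V selB selV =
    def-∀Vec (def-∀Vec def-∀Bool) λ E → def-Realizable E B V selB selV
  def-Extendable (suc n) {env = env} B V selB selV =
    def-∃ (def-Extendable n (B ∘ proj₁) (λ (x , Y) → Y ∷ V x) (weaken ∘ selB) λ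
      { Fin.zero → sel-left {f = proj₂} {g = env ∘ proj₁} ; (Fin.suc p) → weaken (selV p) })

  -- A graph on the smaller vertex set is padded with edges at the vertex to be dropped; `Full-init`
  -- does the same on the other side.
  Full-tail : ∀ {N l} (B : Fin N → Tuple M z) Y (V : Vec (Tuple M u) l) → Full B (Y ∷ V) → Full B V
  Full-tail B Y V full E =
    let e , h = full (Vec.map (true ∷_) E)
    in e , λ q p → subst (λ bs → Signed (lookup bs (Fin.suc p)) (Holds (B q) (lookup V p) e))
                         (lookup-map q (true ∷_) E) (h q (Fin.suc p))

  Full-init : ∀ {N l} (B : Fin (suc N) → Tuple M z) (V : Vec (Tuple M u) l) → Full B V → Full (B ∘ inject₁) V
  Full-init B V full E =
    let e , h = full (E Vec.∷ʳ Vec.replicate _ true)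
    in e , λ q p → subst (λ bs → Signed (lookup bs p) (Holds (B (inject₁ q)) (lookup V p) e))
                         (lookup-∷ʳ E _ q) (h (inject₁ q) p)

  Extendable-init : ∀ n {N l} (B : Fin (suc N) → Tuple M z) (V : Vec (Tuple M u) l) →
                    Extendable n B V → Extendable n (B ∘ inject₁) V
  Extendable-init zero    B V full      = Full-init B V full
  Extendable-init (suc n) B V (Y , ext) = Y , Extendable-init n B (Y ∷ V) ext

  Extendable-pred : ∀ n {N l} (B : Fin N → Tuple M z) (V : Vec (Tuple M u) l) →
                    Extendable (suc n) B V → Extendable n B V
  Extendable-pred zero    B V (Y , full) = Full-tail B Y V full
  Extendable-pred (suc n) B V (Y , ext)  = Y , Extendable-pred n B (Y ∷ V) ext

  Extendable⇒Full : ∀ n {N l} (B : Fin N → Tuple M z) (V : Vec (Tuple M u) l) → Extendable n B V → Full B V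
  Extendable⇒Full zero    B V full = full
  Extendable⇒Full (suc n) B V ext  = Extendable⇒Full n B V (Extendable-pred n B V ext)

  Extendable-[] : ∀ {l} n {N} (B : Fin N → Tuple M z) (V : Vec (Tuple M u) l) →
                  Extendable n B V → Extendable (l ℕ.+ n) B []
  Extendable-[] n B []      ext = ext
  Extendable-[] {l = suc l} n B (Y ∷ V) ext =
    subst (λ k → Extendable k B []) (ℕ.+-suc l n) (Extendable-[] (suc n) B V (Y , ext))

  module _ (κ θ : Cardinal ℓ) (κ-infinite : Infinite κ) (κ<θ : ∣ κ ∣ <ᶜ ∣ θ ∣) (sat : Saturated M θ)
           (bs : ℕ → Tuple M z) where

    first : ∀ N → Fin N → Tuple M z
    first N q = bs (toℕ q)

    first-inject₁ : ∀ N → first (suc N) ∘ inject₁ ≡ first N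
    first-inject₁ N = extensionality λ q → cong bs (Fin.toℕ-inject₁ q)

    -- A single `n` counts both the members of `bs` and the further tuples, so that the conditions
    -- form one decreasing sequence, as `realize` requires.
    AlwaysExtendable : ∀ {l} → Vec (Tuple M u) l → Set ℓ
    AlwaysExtendable V = ∀ n → Extendable n (first n) V

    -- This makes both kinds of parameters entries of one countable sequence.
    paired : ∀ {Γ} → (ℕ → Tuple M Γ) → ℕ → Tuple M (z ++ Γ)
    paired ds n = ++⁺ (bs n) (ds n)

    bs-⊆ : ∀ {Γ} (ds : ℕ → Tuple M Γ) n → _⊆ᴾ_ M (bs n) (entries (paired ds))
    bs-⊆ ds n v = n , ∈-++⁺ˡ v , lookup-++ˡ (bs n) (ds n) v

    ds-⊆ : ∀ {Γ} (ds : ℕ → Tuple M Γ) n → _⊆ᴾ_ M (ds n) (entries (paired ds))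
    ds-⊆ ds n v = n , ∈-++⁺ʳ z v , lookup-++ʳ (bs n) (ds n) v

    saturate : ∀ {Γ Δ} (ds : ℕ → Tuple M Γ) {m : ℕ → ℕ} (Vs : ∀ n → Vec (Tuple M Γ) (m n)) →
               (∀ n p → ∃[ k ] lookup (Vs n) p ≡ ds k) →
               (R : ℕ → Tuple M Δ → Set ℓ) →
               (∀ n → Definable (λ e → ++⁺ e (++⁺ (join M n (first n)) (join M (m n) (lookup (Vs n))))) (R n)) →
               (∀ n e → R (suc n) e → R n e) → (∀ n → ∃ (R n)) → ∃[ e ] (∀ n → R n e)
    saturate ds {m} Vs Vs-ds R R-def desc inhabited =
      realize {θ = θ} sat {A = D} (entries-small κ θ κ<θ κ-infinite (paired ds)) R
        (λ n → mkFormulaOver (Definable.formula (R-def n)) _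
           (⊆-++ {A = D} {d = join M n (first n)}
             (⊆-join {A = D} {d = first n} (bs-⊆ ds ∘ toℕ))
             (⊆-join {A = D} {d = lookup (Vs n)} λ p →
               let k , eq = Vs-ds n p in subst (λ d → _⊆ᴾ_ M d D) (sym eq) (ds-⊆ ds k))))
        (Definable.correct ∘ R-def) desc inhabited
      where
      D = entries (paired ds)

    module _ {Γ Δ : Ctx L} (N : ℕ) {l : ℕ} (V : Vec (Tuple M Γ) l) where

      private
        env : Tuple M Δ → Tuple M (Δ ++ (power {L = L} N z ++ power {L = L} l Γ))
        env e = ++⁺ e (++⁺ (join M N (first N)) (join M l (lookup V)))

        params-sel : Selects env (λ _ → ++⁺ (join M N (first N)) (join M l (lookup V)))
        params-sel = sel-right {f = id}

      first-sel : ∀ q → Selects env (λ _ → first N q)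
      first-sel q = sel-trans params-sel
        (sel-trans {g = λ _ → join M N (first N)} sel-left (sel-component {f = λ _ → first N} q))

      lookup-sel : ∀ p → Selects env (λ _ → lookup V p)
      lookup-sel p = sel-trans params-sel
        (sel-trans {g = λ _ → join M l (lookup V)} (sel-right {f = λ _ → join M N (first N)})
          (sel-component {f = λ _ → lookup V} p))

    -- Of the `suc n` tuples available over `first (suc n)`, one serves as `Y` and `n` remain;
    -- `init` drops the surplus member of `bs`. So each condition on `Y` is satisfiable, and
    -- `saturate` meets them all at once.
    extend : ∀ {l} (V : Vec (Tuple M u) l) → AlwaysExtendable V → ∃[ Y ] AlwaysExtendable (Y ∷ V)
    extend V ext = saturate ds (λ _ → V) (λ _ p → toℕ p , sym (nth-lookup V _ p))
      (λ n Y → Extendable n (first n) (Y ∷ V))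
      (λ n → def-Extendable n (λ _ → first n) (λ Y → Y ∷ V) (first-sel n V) λ
        { Fin.zero → sel-left {f = id} ; (Fin.suc p) → lookup-sel n V p })
      (λ n Y h → init (Y ∷ V) n (Extendable-pred n _ (Y ∷ V) h))
      λ n → let Y , h = ext (suc n) in Y , init (Y ∷ V) n h
      where
      init : ∀ {l} (V : Vec (Tuple M u) l) n → Extendable n (first (suc n)) V → Extendable n (first n) V
      init V n h = subst (λ B → Extendable n B V) (first-inject₁ n) (Extendable-init n (first (suc n)) V h)
      ds : ℕ → Tuple M u
      -- Only the entries of `V` matter; the rest of the sequence is filler.
      ds = nth V (All.tabulate λ {s} _ → Structure.inhabited M s)

    module _ (ext₀ : AlwaysExtendable []) where

      stage : ∀ n → Σ[ V ∈ Vec (Tuple M u) n ] AlwaysExtendable V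
      stage zero    = [] , ext₀
      stage (suc n) = let V , ext = stage n ; Y , ext′ = extend V ext in Y ∷ V , ext′

      as : ℕ → Tuple M u
      as n = Vec.head (proj₁ (stage (suc n)))

      prefix : ∀ n → Vec (Tuple M u) n
      prefix n = proj₁ (stage n)

      lookup-prefix : ∀ n p → lookup (prefix n) p ≡ as (descend p)
      lookup-prefix (suc n) Fin.zero    = refl
      lookup-prefix (suc n) (Fin.suc p) = lookup-prefix n p

      -- Each finite part of the pattern is a graph between a prefix and finitely many `bs`,
      -- realized because every stage is `Full`; saturation joins these parts.
      pattern-realized : (χ : ℕ → ℕ → Bool) → ∃[ e ] (∀ i j → Signed (χ i j) (Holds (bs j) (as i) e))
      pattern-realized χ =
        let e , h = saturate as prefix (λ n p → descend p , lookup-prefix n p) R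
              (λ n → def-∀Fin λ q → def-∀Fin λ p → def-signed (χ (descend p) (toℕ q))
                (def-Holds (first-sel n (prefix n) q) (lookup-sel n (prefix n) p) (sel-left {f = id})))
              desc inhabited
        in e , λ i j →
          -- The first stage that involves both `i` and `j`.
          let n = suc (i ℕ.⊔ j)
              p , p≡i = descend-surjective {n} (ℕ.≤⇒≤′ (ℕ.s≤s (ℕ.m≤m⊔n i j)))
              j<n = ℕ.s≤s (ℕ.m≤n⊔m i j)
          in subst₂ (λ i j → Signed (χ i j) (Holds (bs j) (as i) e)) p≡i (Fin.toℕ-fromℕ< j<n)
               (subst (λ Y → Signed (χ (descend p) (toℕ (fromℕ< j<n))) (Holds (bs (toℕ (fromℕ< j<n))) Y e))
                 (lookup-prefix n p) (h n (fromℕ< j<n) p))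
        where
        R : ℕ → Tuple M w → Set ℓ
        R n e = ∀ q p → Signed (χ (descend p) (toℕ q)) (Holds (first n q) (lookup (prefix n) p) e)

        desc : ∀ n e → R (suc n) e → R n e
        desc n e h q p = subst (λ j → Signed (χ (descend p) j) (Holds (bs j) (lookup (prefix n) p) e))
                           (Fin.toℕ-inject₁ q) (h (inject₁ q) (Fin.suc p))

        inhabited : ∀ n → ∃ (R n)
        inhabited n =
          let e , h = Extendable⇒Full n (first n) (prefix n) (proj₂ (stage n) n)
                        (tabulate λ q → tabulate λ p → χ (descend p) (toℕ q))
          in e , λ q p → subst (λ b → Signed b (Holds (first n q) (lookup (prefix n) p) e))
               (trans (cong (λ r → lookup r p) (lookup∘tabulate _ q)) (lookup∘tabulate _ p)) (h q p)

      -- The variables of φ are permuted: the tuple realizing a pattern comes first, followed by the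
      -- two sequences of parameters.
      not-two-dependent : {T : Theory L} → M IsModelOf T → ∃ (NotTwoDependentFormula T w u z)
      not-two-dependent M-model = Definable.formula φ′ , M , M-model , as , bs , λ S →
        let e , h = pattern-realized (λ i j → does (em (S (i , j))))
        in e , λ i j → signed-dec (em (S (i , j))) (h i j) ⇔-∘ Definable.correct φ′ (e , as i , bs j)
        where
        env : Tuple M w × Tuple M u × Tuple M z → Tuple M (w ++ (u ++ z))
        env (e , Y , B) = ++⁺ e (++⁺ Y B)
        φ′ : Definable env (λ (e , Y , B) → Holds B Y e)
        φ′ = def-Holds
          (sel-trans (sel-right {f = proj₁}) (sel-right {f = proj₁ ∘ proj₂} {g = proj₂ ∘ proj₂}))
          (sel-trans (sel-right {f = proj₁}) (sel-left {f = proj₁ ∘ proj₂} {g = proj₂ ∘ proj₂}))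
          (sel-left {f = proj₁})

  module _ (κ θ : Cardinal ℓ) (κ-infinite : Infinite κ) (κ<θ : ∣ κ ∣ <ᶜ ∣ θ ∣) (sat : Saturated M θ)
           (lam : Cardinal ℓ) (β₀ : Cardinal.Carrier lam) (b : Cardinal.Carrier lam → Tuple M z)
           (C : Params M) (b-indiscernible : IndiscernibleOver M lam C b) (c : Tuple M w) where
    open Cardinal lam renaming (Carrier to Λ)
    open IsStrictTotalOrder isStrictTotalOrder using () renaming (trans to <-trans)

    ShatteredByTails : ∀ {n} → Vec (Tuple M u) n → Set ℓ
    ShatteredByTails Ys = ∀ β bits → ∃[ j ] β < j × (∀ p → Signed (lookup bits p) (Holds (b j) (lookup Ys p) c))

    -- The rows of `E` are realized one after another by the same `c`, each at an index beyond the
    -- bound left by the row before.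
    grid : ∀ {N n} (Ys : Vec (Tuple M u) n) → ShatteredByTails Ys → (E : Vec (Vec Bool n) N) → ∀ β →
           ∃[ j ] Increasing M lam {N} j × (∀ q → β < j q) × Realizes E (b ∘ j) Ys c
    grid Ys tails []         β = (λ ()) , (λ { {()} }) , (λ ()) , λ ()
    grid Ys tails (bits ∷ E) β =
      let j₀ , β<j₀ , h₀ = tails β bits
          j , inc , j₀<j , h = grid Ys tails E j₀
          j′ : Fin _ → Λ
          j′ = λ { Fin.zero → j₀ ; (Fin.suc q) → j q }
      in j′ , (λ { {Fin.zero} {Fin.suc q} _ → j₀<j q ; {Fin.suc p} {Fin.suc q} (ℕ.s≤s p<q) → inc p<q })
         , (λ { Fin.zero → β<j₀ ; (Fin.suc q) → <-trans β<j₀ (j₀<j q) })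
         , λ { Fin.zero → h₀ ; (Fin.suc q) → h q }

    shattered⇒not-two-dependent :
      (∀ n → Σ[ Ys ∈ Vec (Tuple M u) n ] (∀ p → _⊆ᴾ_ M (lookup Ys p) C) × ShatteredByTails Ys) →
      {T : Theory L} → M IsModelOf T → ∃ (NotTwoDependentFormula T w u z)
    shattered⇒not-two-dependent shattered = not-two-dependent κ θ κ-infinite κ<θ sat (b ∘ t) always
      where
      next : ∀ β → ∃[ j ] β < j
      -- For the empty vector, shattering by all tails just says that no index is the last.
      next β = let j , β<j , _ = proj₂ (proj₂ (shattered 0)) β [] in j , β<j

      t : ℕ → Λ
      t zero    = β₀
      t (suc n) = proj₁ (next (t n))

      t-mono : ∀ {m n} → m ℕ.<′ n → t m < t n
      t-mono (ℕ.≤′-reflexive refl) = proj₂ (next _)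
      t-mono (ℕ.≤′-step m<n)       = <-trans (t-mono m<n) (proj₂ (next _))

      full : ∀ N {n} (Ys : Vec (Tuple M u) n) → (∀ p → _⊆ᴾ_ M (lookup Ys p) C) → ShatteredByTails Ys →
             Full {N} (b ∘ t ∘ toℕ) Ys
      full N {n} Ys Ys⊆C tails E =
        let j , inc , _ , h = grid Ys tails E β₀
        -- Quantifying over the realizing tuple removes `c`, so realizability of `E` is a condition
        -- over `C`, and indiscernibility moves it from the `j` found for this `E` to the fixed `t`.
        in to (Definable.correct φE (b ∘ t ∘ toℕ))
             (proj₁ (b-indiscernible N j (t ∘ toℕ) inc (t-mono ∘ ℕ.<⇒<′))
               {mkFormulaOver (Definable.formula φE) (join M n (lookup Ys))
                 (⊆-join {A = C} {d = lookup Ys} Ys⊆C)}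
               (from (Definable.correct φE (b ∘ j)) (c , h)))
        where
        φE : Definable (λ B → ++⁺ (join M N B) (join M n (lookup Ys))) (λ B → Realizable E B Ys)
        φE = def-Realizable E id (const Ys)
               (λ q → sel-trans (sel-left {f = join M N}) (sel-component {f = id} q))
               (λ p → sel-trans (sel-right {f = join M N}) (sel-component {f = const (lookup Ys)} p))

      always : ∀ n → Extendable n (b ∘ t ∘ toℕ {n}) []
      always n = let Ys , Ys⊆C , tails = shattered n in
        subst (λ k → Extendable k (b ∘ t ∘ toℕ {n}) []) (ℕ.+-identityʳ n)
          (Extendable-[] 0 (b ∘ t ∘ toℕ) Ys (full n Ys Ys⊆C tails))

-- Decisions as bits, and numerals among the formulas.

signed-does : ∀ {P : Set a} (d : Dec P) {b} → does d ≡ b → Signed b P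
signed-does (yes p) refl = p
signed-does (no ¬p) refl = ¬p

does-≡⇒⇔ : ∀ {P : Set a} {Q : Set r} (d : Dec P) (d′ : Dec Q) → does d ≡ does d′ → P ⇔ Q
does-≡⇒⇔ (yes p) (yes q) _ = mk⇔ (const q) (const p)
does-≡⇒⇔ (no ¬p) (no ¬q) _ = mk⇔ (⊥-elim ∘ ¬p) (⊥-elim ∘ ¬q)

module _ {L : Language ℓ} where

  numeral : ∀ {Γ} → ℕ → Formula L Γ
  numeral zero    = ⊥̇
  numeral (suc n) = ⊥̇ ⇒̇ numeral n

  value : ∀ {Γ} → Formula L Γ → ℕ
  value (_ ⇒̇ φ) = suc (value φ)
  value _       = 0

  value-numeral : ∀ {Γ} n → value {Γ} (numeral n) ≡ n
  value-numeral zero    = refl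
  value-numeral (suc n) = cong suc (value-numeral n)

  antecedent consequent : ∀ {Γ} → Formula L Γ → Formula L Γ
  antecedent (φ ⇒̇ _) = φ
  antecedent φ       = φ
  consequent (_ ⇒̇ φ) = φ
  consequent φ       = φ

-- Counting the types realized in a tail of J.

module _ (classical : Classical) {L : Language ℓ} {T : Theory L} (two-dependent : TwoDependent T)
  (κ : Cardinal ℓ) (κ-infinite : Infinite κ) (T≤κ : ∣ T ∣ᵀ ≤ᶜ ∣ κ ∣)
  (lam : Cardinal ℓ) (lam-regular : Regular lam) (κ<lam : ∣ κ ∣ <ᶜ ∣ lam ∣)
  (θ : Cardinal ℓ) (κ<θ : ∣ κ ∣ <ᶜ ∣ θ ∣) {M : Structure L} (M-model : M IsModelOf T) (sat : Saturated M θ)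
  (δ : Cardinal ℓ) (bound : BoundsCuts κ δ) {y z w : Ctx L}
  (a : Cardinal.Carrier κ → Tuple M y) (b : Cardinal.Carrier lam → Tuple M z)
  (b-indiscernible : IndiscernibleOver M lam (coords M (range M a)) b) (c : Tuple M w) where

  open Classical classical
  open WellOrders classical
  open Definability classical M
  open CardinalLemmas κ using (<-connex; bounded)

  private
    K = Cardinal.Carrier κ
    Λ = Cardinal.Carrier lam
    Δ = Cardinal.Carrier δ
    module Λ = Cardinal lam

    <Λ-trans : ∀ {i j k} → i Λ.< j → j Λ.< k → i Λ.< k
    <Λ-trans = IsStrictTotalOrder.trans Λ.isStrictTotalOrder

    k₀ : K
    k₀ = Injection.to κ-infinite 0

    β₀ : Λ
    β₀ = Injection.to (proj₁ lam-regular) 0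

    square : Σ[ f ∈ (K × K → K) ] Injective _≡_ _≡_ f
    square = Hessenberg.square-injection (Cardinal.wellFounded κ) <-connex
               (Injection.to κ-infinite) (Injection.injective κ-infinite)

    unpair : K → K × K
    unpair = leftInverse (proj₁ square) (k₀ , k₀)

    unpair-surjective : ∀ kl → unpair (proj₁ square kl) ≡ kl
    unpair-surjective = leftInverse-∘ (proj₁ square) _ (proj₂ square)

    mutual
      vecs : ∀ n → K → Vec K n
      vecs zero    _ = []
      vecs (suc n) k = let l , ls = enum n k in l ∷ ls

      enum : ∀ n → K → K × Vec K n
      enum n k = let l , k′ = unpair k in l , vecs n k′

    mutual
      vecs-surjective : ∀ n → StrictlySurjective _≡_ (vecs n)
      vecs-surjective zero    []       = k₀ , refl
      vecs-surjective (suc n) (l ∷ ls) =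
        let k , eq = enum-surjective n (l , ls) in k , cong (λ (l , ls) → l ∷ ls) eq

      enum-surjective : ∀ n → StrictlySurjective _≡_ (enum n)
      enum-surjective n (l , ls) =
        let k , eq = vecs-surjective n ls
        in proj₁ square (l , k) ,
           trans (cong (λ (l , k′) → l , vecs n k′) (unpair-surjective (l , k))) (cong (l ,_) eq)

  open Shattering classical κ δ bound enum enum-surjective

  Query : Set ℓ
  Query = Σ[ m ∈ ℕ ] Formula L (z ++ (power {L = L} m y ++ w))

  args : ∀ {m} → Vec K m → Tuple M (power {L = L} m y)
  args {m} is = join M m (a ∘ lookup is)

  -- The number `k` codes an `m`-tuple of indices, so that traces are subsets of κ, to which `code`
  -- applies, rather than of κᵐ.
  Holds : (q : Query) → Tuple M z → K → Set ℓ
  Holds (m , φ) e k = M ⊨ φ [ ++⁺ e (++⁺ (args (vecs m k)) c) ]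

  trace : Query → Tuple M z → K → Bool
  trace q e k = does (em (Holds q e k))

  Tail : Query → Λ → Family
  Tail q β f = ∃[ j ] β Λ.< j × trace q (b j) ≡ f

  thin-tail : ∀ q → Σ[ n ∈ ℕ ] Σ[ β ∈ Λ ] ShattersNo n (Tail q β)
  thin-tail q@(m , φ) = by-contradiction λ ∄ →
    let ψ , ψ-independent = shattered⇒not-two-dependent κ θ κ-infinite κ<θ sat lam β₀ b
          (coords M (range M a)) b-indiscernible c (λ n →
            let ws , sh = shattered ∄ n
            in Vec.map (args ∘ vecs m) ws , args-⊆ ws , tails ws sh) {T = T} M-model
    in two-dependent _ _ _ ψ ψ-independent
    where
    open Independence classical M {z} {power {L = L} m y} {w} φ hiding (Holds)

    -- Otherwise each of the κ many vectors fails to be shattered by some tail, and a tail beyond a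
    -- common bound shatters no vector of length `n`.
    shattered : ¬ (Σ[ n ∈ ℕ ] Σ[ β ∈ Λ ] ShattersNo n (Tail q β)) →
                ∀ n → Σ[ ws ∈ Vec K n ] (∀ β → Shatters (Tail q β) ws)
    shattered ∄ n = by-contradiction λ none →
      let escape : ∀ k → ∃[ β ] ¬ Shatters (Tail q β) (vecs n k)
          escape k = by-contradiction λ ∄β → none (vecs n k , λ β → by-contradiction λ ¬sh → ∄β (β , ¬sh))
          β , escape<β = bounded lam lam-regular (proj₂ κ<lam) id id (proj₁ ∘ escape)
      in ∄ (n , β , λ ws sh →
           let k , eq = vecs-surjective n ws
           in proj₂ (escape k) (subst (Shatters (Tail q _)) (sym eq) λ bits →
                let f , (j , β<j , f≡) , map≡ = sh bits
                in f , (j , <Λ-trans (escape<β k) β<j , f≡) , map≡))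

    args-⊆ : ∀ {n} (ws : Vec K n) p → _⊆ᴾ_ M (lookup (Vec.map (args ∘ vecs m) ws) p) (coords M (range M a))
    args-⊆ ws p rewrite lookup-map p (args ∘ vecs m) ws =
      ⊆-join {A = coords M (range M a)} {d = a ∘ lookup (vecs m (lookup ws p))} λ i v →
        _ , (_ , refl) , v , refl

    tails : ∀ {n} (ws : Vec K n) → (∀ β → Shatters (Tail q β) ws) →
            ShatteredByTails κ θ κ-infinite κ<θ sat lam β₀ b (coords M (range M a)) b-indiscernible c
              (Vec.map (args ∘ vecs m) ws)
    tails ws sh β bits with sh β bits
    ... | _ , (j , β<j , refl) , refl = j , β<j , λ p →
      subst (λ Y → Signed (lookup (Vec.map (trace q (b j)) ws) p) (M ⊨ φ [ ++⁺ (b j) (++⁺ Y c) ]))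
        (sym (lookup-map p (args ∘ vecs m) ws))
        (signed-does (em _) (sym (lookup-map p (trace q (b j)) ws)))

  queryCode : Query → (K → Bool) → ℕ → Δ
  queryCode q = let n , β , _ = thin-tail q in code n (Tail q β)

  queryCode-injective : ∀ q {f g} → Tail q (proj₁ (proj₂ (thin-tail q))) f →
                        Tail q (proj₁ (proj₂ (thin-tail q))) g → queryCode q f ≗ queryCode q g → f ≡ g
  queryCode-injective q = let n , β , none = thin-tail q in code-injective n (Tail q β) none

  -- Numerals as antecedents embed Query × ℕ into the formulas, so that a family
  -- of cuts indexed by |T| has room for the whole code of every query.

  label : Query × ℕ → ∃ (Formula L)
  label ((m , φ) , k) = _ , numeral m ⇒̇ (numeral k ⇒̇ φ)

  label-injective : Injective _≡_ _≡_ label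
  label-injective {(m , φ) , k} {(m′ , φ′) , k′} eq
    with trans (sym (value-numeral m)) (trans (cong (λ (_ , χ) → value (antecedent χ)) eq) (value-numeral m′))
       | trans (sym (value-numeral k))
           (trans (cong (λ (_ , χ) → value (antecedent (consequent χ))) eq) (value-numeral k′))
  ... | refl | refl with ,-injectiveʳ eq
  ... | eq′ = cong (λ φ → (m , φ) , k) (cong (consequent ∘ consequent) eq′)

  private
    -- Labels with the number 0 embed the queries into the formulas, so there are at most κ many
    -- thresholds to exceed.
    query-bound : ∃[ β ] (∀ q → proj₁ (proj₂ (thin-tail q)) Λ.< β)
    query-bound = bounded lam lam-regular (proj₂ κ<lam) (λ q → Injection.to T≤κ (label (q , 0)))
      (λ eq → cong proj₁ (label-injective (Injection.injective T≤κ eq))) (proj₁ ∘ proj₂ ∘ thin-tail)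

    β : Λ
    β = proj₁ query-bound

    Ic : Params M
    Ic = coords M (_×｛_｝ M (range M a) c)

    args-c-⊆ : ∀ {m} (is : Vec K m) → _⊆ᴾ_ M (++⁺ (args is) c) Ic
    args-c-⊆ is = ⊆-++ {A = Ic} {d = args is} {e = c}
      (⊆-join {A = Ic} {d = a ∘ lookup is} λ p v →
        _ , (_ , (lookup is p , refl) , refl) , ∈-++⁺ˡ v , lookup-++ˡ (a (lookup is p)) c v)
      -- The entries of `c` are parameters because `I` has a member, here the one at `k₀`.
      λ v → _ , (_ , (k₀ , refl) , refl) , ∈-++⁺ʳ y v , lookup-++ʳ (a k₀) c v

  instanceAt : Query → K → FormulaOver M Ic z
  instanceAt (m , φ) k = mkFormulaOver φ (++⁺ (args (vecs m k)) c) (args-c-⊆ (vecs m k))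

  -- Each entry of `d` occurs in some `a i` followed by `c`. These `i` are collected, while one copy
  -- of `c` serves all entries.
  params-selected : ∀ {z′} (d : Tuple M z′) → _⊆ᴾ_ M d Ic → Σ[ m ∈ ℕ ] Σ[ is ∈ Vec K m ]
                    Selects {X = Tuple M z} (λ _ → ++⁺ (args is) c) (λ _ → d)
  params-selected [] _ = 0 , [] , sel-[]
  params-selected (x ∷ d) d⊆Ic with d⊆Ic (here refl) | params-selected d (d⊆Ic ∘ there)
  ... | _ , (_ , (i , refl) , refl) , v , refl | m , is , sel =
    suc m , i ∷ is , sel-++ (sel-trans (sel-++ (sel-trans left sel-left′) right) entry)
                            (sel-trans (sel-++ (sel-trans left (sel-right {f = λ _ → a i})) right) sel)
    where
    left : Selects {X = Tuple M z} (λ _ → ++⁺ (args (i ∷ is)) c) (λ _ → args (i ∷ is))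
    left = sel-left
    sel-left′ : Selects {X = Tuple M z} (λ _ → ++⁺ (a i) (args is)) (λ _ → a i)
    sel-left′ = sel-left
    right : Selects {X = Tuple M z} (λ _ → ++⁺ (args (i ∷ is)) c) (λ _ → c)
    right = sel-right {f = λ _ → args (i ∷ is)}
    entry : Selects {X = Tuple M z} (λ _ → ++⁺ (a i) c) (λ _ → All.lookup (++⁺ (a i) c) v ∷ [])
    entry = selects (λ { (here refl) → v }) λ { _ (here refl) → refl }

  reduce : (χ : FormulaOver M Ic z) → ∃[ q ] ∃[ k ] (∀ e → tp M Ic e (instanceAt q k) ⇔ tp M Ic e χ)
  reduce (mkFormulaOver ψ d d⊆Ic) with params-selected d d⊆Ic
  ... | m , is , sel with vecs-surjective m is
  ... | k , refl = let φ = def-⊨ (sel-++ sel-left (sel-trans (sel-right {f = id}) sel)) ψ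
                   in (m , Definable.formula φ) , k , Definable.correct φ

  -- Read off the type and not off a realization, so that equal types receive equal codes;
  -- `trace≡typeTrace` links it to `J`.
  typeTrace : Query → Pred (FormulaOver M Ic z) ℓ → K → Bool
  typeTrace q p k = does (em (p (instanceAt q k)))

  typeTrace-cong : ∀ q {p p′} → p ≐ p′ → typeTrace q p ≡ typeTrace q p′
  typeTrace-cong q (p⊆p′ , p′⊆p) = extensionality λ k → does-⇔ (mk⇔ p⊆p′ p′⊆p) (em _) (em _)

  typeTrace-≡ : ∀ q k {p p′} → typeTrace q p ≡ typeTrace q p′ → p (instanceAt q k) ⇔ p′ (instanceAt q k)
  typeTrace-≡ q k {p} {p′} eq =
    does-≡⇒⇔ (em (p (instanceAt q k))) (em (p′ (instanceAt q k))) (cong (λ f → f k) eq)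

  typeCode : Pred (FormulaOver M Ic z) ℓ → ∃ (Formula L) → Δ
  -- Formulas that are not labels get an arbitrary query; injectivity rests on the labels.
  typeCode p χ = let q , k = leftInverse label ((0 , ⊥̇) , 0) χ in queryCode q (typeTrace q p) k

  typeCode-cong : ∀ {p p′} → p ≐ p′ → ∀ χ → typeCode p χ ≡ typeCode p′ χ
  typeCode-cong {p} {p′} p≐p′ χ =
    let q , k = leftInverse label ((0 , ⊥̇) , 0) χ
    in cong (λ f → queryCode q f k) (typeTrace-cong q {p} {p′} p≐p′)

  typeCode-label : ∀ p q k → typeCode p (label (q , k)) ≡ queryCode q (typeTrace q p) k
  typeCode-label p q k = cong (λ (q , k) → queryCode q (typeTrace q p) k)
                           (leftInverse-∘ label _ label-injective (q , k))

  trace≡typeTrace : ∀ q {p} j → p ≐ tp M Ic (b j) → trace q (b j) ≡ typeTrace q p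
  trace≡typeTrace q@(m , φ) {p} j (p⊆ , ⊆p) = extensionality λ k →
    does-⇔ (mk⇔ (⊆p {instanceAt q k}) (p⊆ {instanceAt q k}))
           (em (Holds q (b j) k)) (em (p (instanceAt q k)))

  in-tail : ∀ q {p} j → β Λ.< j → p ≐ tp M Ic (b j) → Tail q (proj₁ (proj₂ (thin-tail q))) (typeTrace q p)
  in-tail q {p} j β<j p≐ = j , <Λ-trans (proj₂ query-bound q) β<j , trace≡typeTrace q {p} j p≐

  -- At the labels the codes determine the traces of every query, since these lie in its thin tail.
  -- By `reduce` the traces decide all formulas over the parameters.
  typeCode-injective : ∀ {p p′} j j′ → β Λ.< j → β Λ.< j′ → p ≐ tp M Ic (b j) → p′ ≐ tp M Ic (b j′) →
                       (∀ χ → typeCode p χ ≡ typeCode p′ χ) → p ≐ p′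
  typeCode-injective {p} {p′} j j′ β<j β<j′ p≐ p′≐ eq =
    (λ {χ} → to (equiv χ)) , (λ {χ} → from (equiv χ))
    where
    traces-≡ : ∀ q → typeTrace q p ≡ typeTrace q p′
    traces-≡ q = queryCode-injective q (in-tail q {p} j β<j p≐) (in-tail q {p′} j′ β<j′ p′≐) λ k →
      trans (sym (typeCode-label p q k)) (trans (eq (label (q , k))) (typeCode-label p′ q k))

    equiv : ∀ χ → p χ ⇔ p′ χ
    equiv χ =
      let q , k , red = reduce χ
          ψ = instanceAt q k
          p⇔p′-at-ψ : p ψ ⇔ p′ ψ
          p⇔p′-at-ψ = typeTrace-≡ q k {p} {p′} (traces-≡ q)
      -- `p` respects the equivalence of `χ` with its instance because both can be evaluated at
      -- `b j`; likewise `p′` at `b j′`.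
      in mk⇔
        (λ pχ → proj₂ p′≐ {χ} (to (red (b j′)) (proj₁ p′≐ {ψ} (to p⇔p′-at-ψ
                  (proj₂ p≐ {ψ} (from (red (b j)) (proj₁ p≐ {χ} pχ)))))))
        (λ p′χ → proj₂ p≐ {χ} (to (red (b j)) (proj₁ p≐ {ψ} (from p⇔p′-at-ψ
                   (proj₂ p′≐ {ψ} (from (red (b j′)) (proj₁ p′≐ {χ} p′χ)))))))

  types-bound : ∃[ β ] S M (tailAfter M lam b β) (_×｛_｝ M (range M a) c)
                         ≤ᶜ (∃ (Formula L) →-setoid Δ)
  types-bound = β , record
    { to        = typeCode ∘ proj₁
    ; cong      = λ {s} {s′} → typeCode-cong {proj₁ s} {proj₁ s′}
    ; injective = λ { {p , _ , (j , β<j , refl) , p≐} {p′ , _ , (j′ , β<j′ , refl) , p′≐} →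
                      typeCode-injective {p} {p′} j j′ β<j β<j′ p≐ p′≐ }
    }

proposition5p6 : Classical →
    ∀ {ℓ : Level} (L : Language ℓ) (T : Theory L) → Complete T → TwoDependent T →
    ∀ (κ : Cardinal ℓ) → Infinite κ → ∣ T ∣ᵀ ≤ᶜ ∣ κ ∣ →
    ∀ (lam : Cardinal ℓ) → Regular lam → ∣ κ ∣ <ᶜ ∣ lam ∣ →
    ∀ (θ : Cardinal ℓ) → ∣ κ ∣ <ᶜ ∣ θ ∣ → ∣ lam ∣ <ᶜ ∣ θ ∣ →
    ∀ (M : Structure L) → IsMonster T θ M →
    ∀ (δ : Cardinal ℓ) → δ IsDed κ →
    ∀ {y z w : Ctx L}
    (a : Cardinal.Carrier κ → Tuple M y) (b : Cardinal.Carrier lam → Tuple M z) →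
    MutuallyIndiscernible M κ lam a b →
    ∀ (c : Tuple M w) →
    ∃[ β ] S M (tailAfter M lam b β) (_×｛_｝ M (range M a) c)
    ≤ᶜ (Setoid.Carrier (∣ T ∣ᵀ) →-setoid Cardinal.Carrier δ)
proposition5p6 classical L T _ two-dependent κ κ-infinite T≤κ lam lam-regular κ<lam θ κ<θ _ M monster δ δ-ded
  a b (_ , b-indiscernible) c =
  types-bound classical two-dependent κ κ-infinite T≤κ lam lam-regular κ<lam θ κ<θ
    (IsMonster.isModel monster) (IsMonster.saturated monster) δ (proj₁ δ-ded) a b b-indiscernible c
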